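{- Every generalized augmented cube is fractional strongly maximally matched, and every restricted generalized a-cube is fractional strongly super matched.
   Context: $G-F$ deletes the vertices and edges of $F\subseteq V(G)\cup E(G)$; $\delta(G)$ is the minimum degree. A fractional perfect matching is $f:E(G)\to[0,1]$ with $\sum_{e\ni v}f(e)=1$ for all vertices $v$. $F$ is a fractional strong matching preclusion (FSMP) set if $G-F$ has no fractional perfect matching; $fsmp(G)$ is the minimum size of an FSMP set; optimal means $|F|=fsmp(G)$. $G$ is fractional strongly maximally matched if $fsmp(G)=\delta(G)$, and fractional strongly super matched if moreover $G-F$ has an isolated vertex for every optimal FSMP set $F$. The augmented cube $AQ_n$: vertices are $n$-bit binary strings; $AQ_1\cong K_2$; for $n\geq2$, take copies $AQ^0_{n-1},AQ^1_{n-1}$ of $AQ_{n-1}$ (prefixes $0$, $1$) and join $0u_1\cdots u_{n-1}$ to $1v_1\cdots v_{n-1}$ iff $u_i=v_i$ for all $i$ or $u_i\neq v_i$ for all $i$. Generalized augmented cubes: $\mathcal{GAQ}_4=\{AQ_4\}$; for $n\geq5$, $\mathcal{GAQ}_n$ consists of all graphs $(V_1\cup V_2,E_1\cup E_2\cup M_1\cup M_2)$ with $(V_1,E_1),(V_2,E_2)\in\mathcal{GAQ}_{n-1}$ on disjoint vertex sets and $M_1,M_2$ edge-disjoint perfect matchings between $V_1$ and $V_2$; a generalized augmented cube is a member of some $\mathcal{GAQ}_n$, $n\geq 4$. Restricted generalized a-cubes: $\mathcal{RGAQ}_4=\{AQ_4\}$; for $n\geq5$, $\mathcal{RGAQ}_n$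 consists of all graphs built as for $\mathcal{GAQ}_n$ (from $(V_1,E_1),(V_2,E_2)\in\mathcal{GAQ}_{n-1}$) but with the additional requirement that $M_1\cup M_2$ induces neither a $4$-cycle nor a $6$-cycle; a restricted generalized a-cube is a member of some $\mathcal{RGAQ}_n$, $n\geq4$.
   Formalization: Fractional perfect matchings take rational values in [0,1] instead of real ones; for finite graphs a real fractional perfect matching exists exactly when a rational one does. -}

module Defs where

open import Data.Nat using (ℕ; zero; suc; _+_; _≤_; _<ᵇ_)
open import Data.Bool using (Bool; true; false; _∧_; _∨_; not; if_then_else_)
open import Data.Fin using (Fin; zero; suc; toℕ; splitAt; _↑ˡ_; _↑ʳ_; inject₁; fromℕ) renaming (_≟_ to _≟ᶠ_)
open import Data.Fin.Permutation using (Permutation′; _⟨$⟩ʳ_)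
open import Data.Sum using (inj₁; inj₂)
open import Data.List using (List; []; _∷_; map; foldr; concatMap; allFin)
open import Data.Product using (Σ; _×_; _,_; ∃)
open import Data.Rational using (ℚ; 0ℚ; 1ℚ) renaming (_+_ to _+ℚ_; _≤_ to _≤ℚ_)
open import Relation.Nullary using (¬_; Dec; yes; no)
open import Relation.Nullary.Decidable using (⌊_⌋)
open import Relation.Binary.PropositionalEquality using (_≡_; _≢_)
open import Function.Definitions using (Injective)

-- Simple graphs on the vertex set Fin m, given by a Boolean adjacency
-- relation (all graphs built below are symmetric and loop-free).

Graph : ℕ → Set
Graph m = Fin m → Fin m → Bool

countB : List Bool → ℕ
countB []           = 0
countB (true  ∷ bs) = suc (countB bs)
countB (false ∷ bs) = countB bs

sumℚ : List ℚ → ℚ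
sumℚ = foldr _+ℚ_ 0ℚ

deg : ∀ {m} → Graph m → Fin m → ℕ
deg {m} G v = countB (map (G v) (allFin m))

IsMinDegree : ∀ {m} → Graph m → ℕ → Set
IsMinDegree G d = (∃ λ v → deg G v ≡ d) × (∀ v → d ≤ deg G v)

-- A set F ⊆ V(G) ∪ E(G): a set of vertices and a set of edges.
-- The edge {u,v} of G belongs to F iff delE u v ∨ delE v u.

record Fault (m : ℕ) : Set where
  constructor fault
  field
    delV : Fin m → Bool
    delE : Fin m → Fin m → Bool
open Fault public

size : ∀ {m} → Graph m → Fault m → ℕ
size {m} G F =
  countB (map (delV F) (allFin m)) +
  countB (concatMap (λ i → map (λ j → (toℕ i <ᵇ toℕ j) ∧ G i j ∧ (delE F i j ∨ delE F j i))
                               (allFin m))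
                    (allFin m))

alive : ∀ {m} → Graph m → Fault m → Fin m → Fin m → Bool
alive G F u v = not (delV F u) ∧ not (delV F v) ∧ G u v ∧ not (delE F u v ∨ delE F v u)

-- a fractional perfect matching of G - F (weights on edges, as a
-- symmetric function on the surviving edges; values elsewhere are ignored)
record FracPerfectMatching {m} (G : Graph m) (F : Fault m) : Set where
  field
    f      : Fin m → Fin m → ℚ
    symm   : ∀ u v → alive G F u v ≡ true → f u v ≡ f v u
    lower  : ∀ u v → alive G F u v ≡ true → 0ℚ ≤ℚ f u v
    upper  : ∀ u v → alive G F u v ≡ true → f u v ≤ℚ 1ℚ
    perfect : ∀ v → delV F v ≡ false →
              sumℚ (map (λ u → if alive G F v u then f v u else 0ℚ) (allFin m)) ≡ 1ℚ

IsFSMP : ∀ {m} → Graph m → Fault m → Set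
IsFSMP G F = ¬ FracPerfectMatching G F

IsFsmpNumber : ∀ {m} → Graph m → ℕ → Set
IsFsmpNumber G k =
  (Σ (Fault _) λ F → IsFSMP G F × size G F ≡ k) ×
  (∀ F → IsFSMP G F → k ≤ size G F)

OptimalFSMP : ∀ {m} → Graph m → Fault m → Set
OptimalFSMP G F = IsFSMP G F × (∀ F′ → IsFSMP G F′ → size G F ≤ size G F′)

HasIsolatedVertex : ∀ {m} → Graph m → Fault m → Set
HasIsolatedVertex G F = ∃ λ v → delV F v ≡ false × (∀ u → alive G F v u ≡ false)

FracStronglyMaximallyMatched : ∀ {m} → Graph m → Set
FracStronglyMaximallyMatched G = Σ ℕ λ k → IsFsmpNumber G k × IsMinDegree G k

FracStronglySuperMatched : ∀ {m} → Graph m → Set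
FracStronglySuperMatched G =
  FracStronglyMaximallyMatched G ×
  (∀ F → OptimalFSMP G F → HasIsolatedVertex G F)

_≅_ : ∀ {m} → Graph m → Graph m → Set
_≅_ {m} G H = Σ (Permutation′ m) λ σ → ∀ u v → H (σ ⟨$⟩ʳ u) (σ ⟨$⟩ʳ v) ≡ G u v

cross : ∀ {m} → (Fin m → Fin m) → (Fin m → Fin m) → Fin m → Fin m → Bool
cross π₁ π₂ x y = ⌊ y ≟ᶠ π₁ x ⌋ ∨ ⌊ y ≟ᶠ π₂ x ⌋

join : ∀ {m} → Graph m → Graph m → (Fin m → Fin m) → (Fin m → Fin m) → Graph (m + m)
join {m} G₁ G₂ π₁ π₂ u v with splitAt m u | splitAt m v
... | inj₁ a | inj₁ b = G₁ a b
... | inj₁ a | inj₂ b = cross π₁ π₂ a b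
... | inj₂ a | inj₁ b = cross π₁ π₂ b a
... | inj₂ a | inj₂ b = G₂ a b

-- Augmented cubes.  aqSize k = 2^(k+1), AQ k = AQ_{k+1}; the vertex
-- x ↑ˡ _ is 0x and _ ↑ʳ x is 1x.

aqSize : ℕ → ℕ
aqSize zero    = 2
aqSize (suc k) = aqSize k + aqSize k

compl : ∀ k → Fin (aqSize k) → Fin (aqSize k)
compl zero zero          = suc zero
compl zero (suc zero)    = zero
compl (suc k) x with splitAt (aqSize k) x
... | inj₁ a = aqSize k ↑ʳ compl k a
... | inj₂ a = compl k a ↑ˡ aqSize k

AQ : ∀ k → Graph (aqSize k)
AQ zero zero       zero       = false
AQ zero zero       (suc zero) = true
AQ zero (suc zero) zero       = true
AQ zero (suc zero) (suc zero) = false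
AQ (suc k) = join (AQ k) (AQ k) (λ x → x) (compl k)

AQ₄ : Graph (aqSize 3)
AQ₄ = AQ 3

-- Cycles: HasCycle G k  means G contains a cycle of length (suc k)
-- on pairwise distinct vertices w 0, …, w k.

HasCycle : ∀ {m} → Graph m → ℕ → Set
HasCycle {m} G k =
  Σ (Fin (suc k) → Fin m) λ w →
    Injective _≡_ _≡_ w ×
    (∀ (i : Fin k) → G (w (inject₁ i)) (w (suc i)) ≡ true) ×
    G (w (fromℕ k)) (w zero) ≡ true

matchingGraph : ∀ {m} → (Fin m → Fin m) → (Fin m → Fin m) → Graph (m + m)
matchingGraph π₁ π₂ = join (λ _ _ → false) (λ _ _ → false) π₁ π₂

-- Generalized augmented cubes: GAQ n m G  means G (on Fin m) is (an
-- isomorphic copy of) a member of 𝒢𝒜𝒬_n.  Perfect matchings between the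
-- two vertex sets are bijections π₁, π₂; edge-disjoint: π₁ x ≢ π₂ x.

data GAQ : (n m : ℕ) → Graph m → Set where
  base : GAQ 4 (aqSize 3) AQ₄
  step : ∀ {n m G₁ G₂} (π₁ π₂ : Permutation′ m) →
         GAQ n m G₁ → GAQ n m G₂ →
         (∀ x → π₁ ⟨$⟩ʳ x ≢ π₂ ⟨$⟩ʳ x) →
         GAQ (suc n) (m + m) (join G₁ G₂ (π₁ ⟨$⟩ʳ_) (π₂ ⟨$⟩ʳ_))
  iso  : ∀ {n m G H} → GAQ n m G → G ≅ H → GAQ n m H

data RGAQ : (n m : ℕ) → Graph m → Set where
  base : RGAQ 4 (aqSize 3) AQ₄
  step : ∀ {n m G₁ G₂} (π₁ π₂ : Permutation′ m) →
         GAQ n m G₁ → GAQ n m G₂ →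
         (∀ x → π₁ ⟨$⟩ʳ x ≢ π₂ ⟨$⟩ʳ x) →
         ¬ HasCycle (matchingGraph (π₁ ⟨$⟩ʳ_) (π₂ ⟨$⟩ʳ_)) 3 →
         ¬ HasCycle (matchingGraph (π₁ ⟨$⟩ʳ_) (π₂ ⟨$⟩ʳ_)) 5 →
         RGAQ (suc n) (m + m) (join G₁ G₂ (π₁ ⟨$⟩ʳ_) (π₂ ⟨$⟩ʳ_))
  iso  : ∀ {n m G H} → RGAQ n m G → G ≅ H → RGAQ n m H

{-# OPTIONS --safe #-}

-- If G − F has no fractional perfect matching, Hall's theorem for the bipartite double cover of
-- G − F gives an independent set I of G − F with fewer than |I| neighbours.  Every edge of G inside I
-- is then deleted, and every vertex of the boundary ∂I is deleted, loses an edge to I, or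
-- is still a neighbour of I, so that e(I) + |∂I| ≤ |F| + |I| − 1.  It therefore suffices that
--     e(I) + |∂I| ≥ |I| + 2n − 2   for nonempty I,
-- with a gain of 1 when |I| ≥ 2 in the restricted case.  For a join this is immediate: if I meets
-- both halves, the two bounds add up to more than enough, and otherwise the two matchings
-- contribute at least 2 boundary vertices, or 3 if |I| ≥ 2 and there is no 4-cycle.  For AQ₄ the
-- bounds, including the gain of 1, are verified by computation over pairs of subsets of AQ₃.
module Submission where

open import Defs
open import Data.Bool using (Bool; true; false; _∧_; _∨_; not; if_then_else_)
open import Data.Bool.ListAction using (all)
open import Data.Bool.Properties using (∧-conicalˡ; ∧-conicalʳ; ∨-zeroʳ; ∨-comm; ¬-not; T-≡) renaming (_≟_ to _≟ᵇ_)
open import Data.Empty using (⊥; ⊥-elim)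
open import Data.Fin using (Fin; zero; suc; toℕ; splitAt; inject₁; _↑ˡ_; _↑ʳ_; _≟_)
open import Data.Fin.Permutation using (Permutation′; _⟨$⟩ʳ_; _⟨$⟩ˡ_; inverseˡ; inverseʳ)
open import Data.Fin.Properties using
  (any?; all?; ¬∀⟶∃¬; splitAt-↑ˡ; splitAt-↑ʳ; splitAt⁻¹-↑ˡ; splitAt⁻¹-↑ʳ; ↑ˡ-injective; ↑ʳ-injective; toℕ-injective)
open import Data.List using (List; []; _∷_; _++_; map; concatMap; tabulate; allFin)
open import Data.List.Membership.Propositional using (_∈_)
open import Data.List.Membership.Propositional.Properties using (∈-map⁺; ∈-++⁺ˡ; ∈-++⁺ʳ)
open import Data.List.Properties using (map-tabulate)
import Data.List.Relation.Unary.All as All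
open import Data.List.Relation.Unary.All.Properties using (all⁺)
open import Data.List.Relation.Unary.Any using (here)
open import Data.Nat using (ℕ; zero; suc; _+_; _*_; _≤_; _<_; _<ᵇ_; _≤ᵇ_; _<?_; _≤?_; z≤n; s≤s) renaming (_≟_ to _≟ⁿ_)
open import Data.Nat.Properties using
  ( +-0-commutativeMonoid; ≤-refl; ≤-reflexive; ≤-trans; ≤-<-trans; <-≤-trans; ≤-pred; <-cmp; <⇒<ᵇ;
    <ᵇ⇒<; ≤ᵇ⇒≤; ≮⇒≥; ≰⇒>; 1+n≰n; n≤1+n; suc-injective; +-comm; +-assoc; +-identityʳ; +-suc; +-mono-≤;
    +-monoˡ-≤; +-monoʳ-≤; +-monoʳ-<; +-mono-<-≤; +-mono-≤-<; +-cancelˡ-<; +-cancelʳ-<; +-cancelʳ-≤;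
    *-monoʳ-≤; *-cancelˡ-≤; m≤m+n; m≤n+m; module ≤-Reasoning)
open import Data.Nat.Tactic.RingSolver using (solve-∀)
open import Data.Product using (_×_; _,_; ∃; proj₁; proj₂)
open import Data.Rational using (ℚ; 0ℚ; 1ℚ; ½) renaming (_+_ to _+ℚ_; _≤_ to _≤ℚ_)
import Data.Rational.Properties as ℚ
open import Data.Sum using (_⊎_; inj₁; inj₂; [_,_]′)
open import Data.Vec as Vec using (Vec; []; _∷_)
open import Data.Vec.Properties using (lookup∘tabulate)
open import Function using (_∘_; Equivalence)
open import Function.Definitions using (Injective)
open import Relation.Binary.Definitions using (tri<; tri≈; tri>)
open import Relation.Binary.PropositionalEquality using
  (_≡_; _≢_; refl; sym; trans; cong; cong₂; subst; subst₂; module ≡-Reasoning)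
open import Relation.Nullary using (¬_; Dec; yes; no; ¬?; contradiction)
open import Relation.Nullary.Decidable using (⌊_⌋; isYes≗does; _×-dec_; toWitness)
open import Algebra.Properties.CommutativeMonoid.Sum +-0-commutativeMonoid
  using (sum; sum-cong-≗; ∑-distrib-+; ∑-comm; sum-permute; sum-replicate-zero)
import Algebra.Properties.CommutativeMonoid.Sum ℚ.+-0-commutativeMonoid as Sumℚ

private variable
  m n : ℕ

-- Boolean predicates and their cardinalities

isYes-true : {A : Set} (d : Dec A) → A → ⌊ d ⌋ ≡ true
isYes-true (yes _) a = refl
isYes-true (no ¬a) a = contradiction a ¬a

true-isYes : {A : Set} (d : Dec A) → ⌊ d ⌋ ≡ true → A
true-isYes (yes a) _ = a

isYes-false : {A : Set} (d : Dec A) → ¬ A → ⌊ d ⌋ ≡ false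
isYes-false (yes a) ¬a = contradiction a ¬a
isYes-false (no _)  _  = refl

∧-intro : ∀ {a b} → a ≡ true → b ≡ true → a ∧ b ≡ true
∧-intro refl refl = refl

∨-introˡ : ∀ {a b} → a ≡ true → a ∨ b ≡ true
∨-introˡ refl = refl

∨-introʳ : ∀ {a b} → b ≡ true → a ∨ b ≡ true
∨-introʳ {a} refl = ∨-zeroʳ a

∨-elim : ∀ {a b} → a ∨ b ≡ true → a ≡ true ⊎ b ≡ true
∨-elim {true}  _ = inj₁ refl
∨-elim {false} h = inj₂ h

not-true : ∀ {a} → not a ≡ true → a ≡ false
not-true {false} _ = refl

true≢false : ∀ {a} → a ≡ true → a ≢ false
true≢false refl ()

⟦_⟧ : Bool → ℕ
⟦ b ⟧ = if b then 1 else 0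

⟦⟧-mono : ∀ {a b} → (a ≡ true → b ≡ true) → ⟦ a ⟧ ≤ ⟦ b ⟧
⟦⟧-mono {false} _ = z≤n
⟦⟧-mono {true} {b} h rewrite h refl = ≤-refl

⟦⟧-∨ : ∀ {a b c} → (a ≡ true → b ≡ true ⊎ c ≡ true) → ⟦ a ⟧ ≤ ⟦ b ⟧ + ⟦ c ⟧
⟦⟧-∨ {false} _ = z≤n
⟦⟧-∨ {true} {b} h with h refl
... | inj₁ refl = s≤s z≤n
... | inj₂ refl = m≤n+m 1 ⟦ b ⟧

count : (Fin m → Bool) → ℕ
count P = sum (λ i → ⟦ P i ⟧)

sum-mono : {f g : Fin m → ℕ} → (∀ i → f i ≤ g i) → sum f ≤ sum g
sum-mono {zero}  _ = z≤n
sum-mono {suc m} h = +-mono-≤ (h zero) (sum-mono (h ∘ suc))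

sum-mono-< : {f g : Fin m → ℕ} → (∀ i → f i ≤ g i) → ∀ j → f j < g j → sum f < sum g
sum-mono-< h zero    lt = +-mono-<-≤ lt (sum-mono (h ∘ suc))
sum-mono-< h (suc j) lt = +-mono-≤-< (h zero) (sum-mono-< (h ∘ suc) j lt)

sum-+-mono : {f g h k : Fin m → ℕ} → (∀ i → f i + g i ≤ h i + k i) → sum f + sum g ≤ sum h + sum k
sum-+-mono {f = f} {g} {h} {k} p =
  subst₂ _≤_ (∑-distrib-+ f g) (∑-distrib-+ h k) (sum-mono p)

sum-++ : ∀ m {n} (f : Fin (m + n) → ℕ) → sum f ≡ sum (λ i → f (i ↑ˡ n)) + sum (λ j → f (m ↑ʳ j))
sum-++ zero    f = refl
sum-++ (suc m) f = trans (cong (f zero +_) (sum-++ m (f ∘ suc))) (sym (+-assoc (f zero) _ _))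

count-mono : {P Q : Fin m → Bool} → (∀ i → P i ≡ true → Q i ≡ true) → count P ≤ count Q
count-mono h = sum-mono (λ i → ⟦⟧-mono (h i))

count-single : (x : Fin m) → count (λ i → ⌊ i ≟ x ⌋) ≡ 1
count-single {suc m} zero    = cong suc (sum-replicate-zero m)
count-single {suc m} (suc x) = trans
  (sum-cong-≗ (λ i → cong ⟦_⟧ (trans (isYes≗does (suc i ≟ suc x)) (sym (isYes≗does (i ≟ x))))))
  (count-single x)

_∖_ : (Fin m → Bool) → Fin m → Fin m → Bool
(P ∖ x) i = P i ∧ not ⌊ i ≟ x ⌋

∖-intro : (P : Fin m → Bool) {x i : Fin m} → P i ≡ true → i ≢ x → (P ∖ x) i ≡ true
∖-intro P {x} {i} Pi i≢x = ∧-intro Pi (cong not (isYes-false (i ≟ x) i≢x))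

count-∖-≤ : (P : Fin m → Bool) {x : Fin m} → P x ≡ true → suc (count (P ∖ x)) ≤ count P
count-∖-≤ P {x} Px = subst (_≤ count P) (cong (_+ count (P ∖ x)) (count-single x))
  (subst (_≤ count P) (∑-distrib-+ (λ i → ⟦ ⌊ i ≟ x ⌋ ⟧) _) (sum-mono pointwise))
  where
  pointwise : ∀ i → ⟦ ⌊ i ≟ x ⌋ ⟧ + ⟦ (P ∖ x) i ⟧ ≤ ⟦ P i ⟧
  pointwise i with i ≟ x
  ... | yes refl rewrite Px = ≤-refl
  ... | no _ = ⟦⟧-mono (∧-conicalˡ (P i) true)

count-≤-∖ : (P : Fin m → Bool) (x : Fin m) → count P ≤ suc (count (P ∖ x))
count-≤-∖ P x = subst (count P ≤_) (cong (_+ count (P ∖ x)) (count-single x))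
  (subst (count P ≤_) (∑-distrib-+ (λ i → ⟦ ⌊ i ≟ x ⌋ ⟧) _) (sum-mono pointwise))
  where
  pointwise : ∀ i → ⟦ P i ⟧ ≤ ⟦ ⌊ i ≟ x ⌋ ⟧ + ⟦ (P ∖ x) i ⟧
  pointwise i with P i | ⌊ i ≟ x ⌋
  ... | false | _     = z≤n
  ... | true  | true  = ≤-refl
  ... | true  | false = ≤-refl

1≤count : (P : Fin m → Bool) {x : Fin m} → P x ≡ true → 1 ≤ count P
1≤count P Px = ≤-trans (s≤s z≤n) (count-∖-≤ P Px)

2≤count : (P : Fin m → Bool) {x y : Fin m} → P x ≡ true → P y ≡ true → y ≢ x → 2 ≤ count P
2≤count P {x} Px Py y≢x = ≤-trans (s≤s (1≤count (P ∖ x) (∖-intro P Py y≢x))) (count-∖-≤ P Px)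

3≤count : (P : Fin m → Bool) {x y z : Fin m} → P x ≡ true → P y ≡ true → P z ≡ true →
          y ≢ x → z ≢ x → z ≢ y → 3 ≤ count P
3≤count P {x} Px Py Pz y≢x z≢x z≢y =
  ≤-trans (s≤s (2≤count (P ∖ x) (∖-intro P Py y≢x) (∖-intro P Pz z≢x) z≢y)) (count-∖-≤ P Px)

count-positive : (P : Fin m → Bool) → 1 ≤ count P → ∃ λ x → P x ≡ true
count-positive {suc m} P h with P zero in eq
... | true  = zero , eq
... | false with count-positive (P ∘ suc) h
...   | x , Px = suc x , Px

two-elements : (P : Fin m → Bool) → 2 ≤ count P → ∃ λ x → ∃ λ y → P x ≡ true × P y ≡ true × y ≢ x
two-elements P h with count-positive P (≤-trans (s≤s z≤n) h)
... | x , Px with count-positive (P ∖ x) (≤-pred (≤-trans h (count-≤-∖ P x)))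
...   | y , Qy = x , y , Px , ∧-conicalˡ (P y) _ Qy , λ y≡x →
        true≢false (isYes-true (y ≟ x) y≡x) (not-true (∧-conicalʳ (P y) _ Qy))

some : (Fin m → Bool) → Bool
some {zero}  P = false
some {suc m} P = P zero ∨ some (P ∘ suc)

some-intro : (P : Fin m → Bool) (i : Fin m) → P i ≡ true → some P ≡ true
some-intro P zero    h = ∨-introˡ h
some-intro P (suc i) h = ∨-introʳ (some-intro (P ∘ suc) i h)

some-elim : (P : Fin m → Bool) → some P ≡ true → ∃ λ i → P i ≡ true
some-elim {suc m} P h with ∨-elim {P zero} h
... | inj₁ p = zero , p
... | inj₂ q with some-elim (P ∘ suc) q
...   | i , p = suc i , p

nbhd : Graph m → (Fin m → Bool) → Fin m → Bool
nbhd R A y = some (λ x → A x ∧ R x y)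

nbhd-intro : (R : Graph m) (A : Fin m → Bool) {x y : Fin m} → A x ≡ true → R x y ≡ true → nbhd R A y ≡ true
nbhd-intro R A {x} {y} Ax Rxy = some-intro (λ z → A z ∧ R z y) x (∧-intro Ax Rxy)

nbhd-elim : (R : Graph m) (A : Fin m → Bool) {y : Fin m} → nbhd R A y ≡ true →
            ∃ λ x → A x ≡ true × R x y ≡ true
nbhd-elim R A {y} h with some-elim (λ z → A z ∧ R z y) h
... | x , p = x , ∧-conicalˡ (A x) _ p , ∧-conicalʳ (A x) _ p

-- Hall's theorem

edges : Graph m → ℕ
edges R = sum (λ x → count (R x))

-- Throughout Hall's theorem a `Graph` is read as a bipartite graph between two copies of `Fin m`,
-- so one ordered pair is one edge.
delete : Graph m → Fin m → Fin m → Graph m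
delete R x y u v = R u v ∧ not (⌊ u ≟ x ⌋ ∧ ⌊ v ≟ y ⌋)

delete-≢ˡ : (R : Graph m) {x y u v : Fin m} → R u v ≡ true → u ≢ x → delete R x y u v ≡ true
delete-≢ˡ R {x} {u = u} Ruv u≢x rewrite isYes-false (u ≟ x) u≢x = ∧-intro Ruv refl

delete-≢ʳ : (R : Graph m) {x y u v : Fin m} → R u v ≡ true → v ≢ y → delete R x y u v ≡ true
delete-≢ʳ R {x} {y} {u} {v} Ruv v≢y rewrite isYes-false (v ≟ y) v≢y with ⌊ u ≟ x ⌋
... | true  = ∧-intro Ruv refl
... | false = ∧-intro Ruv refl

edges-delete : (R : Graph m) {x y : Fin m} → R x y ≡ true → edges (delete R x y) < edges R
edges-delete R {x} {y} Rxy =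
  sum-mono-< (λ u → count-mono (λ v → ∧-conicalˡ (R u v) _)) x
    (sum-mono-< (λ v → ⟦⟧-mono (∧-conicalˡ (R x v) _)) y strict)
  where
  strict : ⟦ delete R x y x y ⟧ < ⟦ R x y ⟧
  strict rewrite Rxy | isYes-true (x ≟ x) refl | isYes-true (y ≟ y) refl = ≤-refl

Deficient : Graph m → (Fin m → Bool) → Set
Deficient R A = count (nbhd R A) < count A

-- A perfect matching of the bipartite graph is a permutation. The inverse is stored because the
-- fractional weights at `v` come from both `to v` and `from v`.
record Matching (R : Graph m) : Set where
  field
    to       : Fin m → Fin m
    from     : Fin m → Fin m
    edge     : ∀ x → R x (to x) ≡ true
    to-from  : ∀ y → to (from y) ≡ y
    from-to  : ∀ x → from (to x) ≡ x

-- If deleting either of two edges at x makes R deficient, then so is R: the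
-- neighbourhoods are submodular, and one of A₁ ∪ A₂ and (A₁ ∩ A₂) ∖ x is deficient.
deficient-delete : (R : Graph m) {x y₁ y₂ : Fin m} → y₁ ≢ y₂ →
                   ∃ (Deficient (delete R x y₁)) → ∃ (Deficient (delete R x y₂)) → ∃ (Deficient R)
deficient-delete {m} R {x} {y₁} {y₂} y₁≢y₂ (A₁ , def₁) (A₂ , def₂) with A₁ x in A₁x | A₂ x in A₂x
-- If `x` is not in `A₁`, the deleted edge starts outside `A₁`, so `A₁` has the same neighbours in
-- `R`.
... | false | _ = A₁ , ≤-<-trans (count-mono mono) def₁
  where
  mono : ∀ y → nbhd R A₁ y ≡ true → nbhd (delete R x y₁) A₁ y ≡ true
  mono y h with nbhd-elim R A₁ h
  ... | z , Az , Rzy = nbhd-intro (delete R x y₁) A₁ Az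
          (delete-≢ˡ R Rzy λ { refl → true≢false Az A₁x })
... | true | false = A₂ , ≤-<-trans (count-mono mono) def₂
  where
  mono : ∀ y → nbhd R A₂ y ≡ true → nbhd (delete R x y₂) A₂ y ≡ true
  mono y h with nbhd-elim R A₂ h
  ... | z , Az , Rzy = nbhd-intro (delete R x y₂) A₂ Az
          (delete-≢ˡ R Rzy λ { refl → true≢false Az A₂x })
... | true | true = result
  where
  R₁ R₂ : Graph m
  R₁ = delete R x y₁
  R₂ = delete R x y₂
  C D : Fin m → Bool
  C z = A₁ z ∨ A₂ z
  D z = A₁ z ∧ (A₂ ∖ x) z

  ⟦⟧-submodular : ∀ {a b c d} → (d ≡ true → a ≡ true × b ≡ true) → (c ≡ true → a ≡ true ⊎ b ≡ true) →
                  ⟦ c ⟧ + ⟦ d ⟧ ≤ ⟦ a ⟧ + ⟦ b ⟧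
  ⟦⟧-submodular {c = c} {false} _ g rewrite +-identityʳ ⟦ c ⟧ = ⟦⟧-∨ g
  ⟦⟧-submodular {c = c} {true} f _ with f refl
  ... | refl , refl = +-monoˡ-≤ 1 (⟦⟧-mono {c} (λ _ → refl))

  both : ∀ y → nbhd R D y ≡ true → nbhd R₁ A₁ y ≡ true × nbhd R₂ A₂ y ≡ true
  both y h with nbhd-elim R D h
  ... | z , Dz , Rzy = nbhd-intro R₁ A₁ (∧-conicalˡ (A₁ z) _ Dz) (delete-≢ˡ R Rzy z≢x)
                     , nbhd-intro R₂ A₂ (∧-conicalˡ (A₂ z) _ A₂z) (delete-≢ˡ R Rzy z≢x)
    where
    A₂z = ∧-conicalʳ (A₁ z) _ Dz
    z≢x : z ≢ x
    z≢x z≡x = true≢false (isYes-true (z ≟ x) z≡x) (not-true (∧-conicalʳ (A₂ z) _ A₂z))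

  either : ∀ y → nbhd R C y ≡ true → nbhd R₁ A₁ y ≡ true ⊎ nbhd R₂ A₂ y ≡ true
  either y h with nbhd-elim R C h
  ... | z , Cz , Rzy with z ≟ x
  ...   | no z≢x with ∨-elim Cz
  ...     | inj₁ A₁z = inj₁ (nbhd-intro R₁ A₁ A₁z (delete-≢ˡ R Rzy z≢x))
  ...     | inj₂ A₂z = inj₂ (nbhd-intro R₂ A₂ A₂z (delete-≢ˡ R Rzy z≢x))
  -- An edge at `x` is missing from at most one of `R₁` and `R₂`, since `y₁ ≢ y₂`, and `x` lies in
  -- both `A₁` and `A₂`.
  either y h | z , Cz , Rzy | yes refl = split (y ≟ y₁)
    where
    split : Dec (y ≡ y₁) → nbhd R₁ A₁ y ≡ true ⊎ nbhd R₂ A₂ y ≡ true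
    split (no y≢y₁)  = inj₁ (nbhd-intro R₁ A₁ A₁x (delete-≢ʳ R Rzy y≢y₁))
    split (yes refl) = inj₂ (nbhd-intro R₂ A₂ A₂x (delete-≢ʳ R Rzy y₁≢y₂))

  ⟦⟧-modular : ∀ a b e → ⟦ a ⟧ + ⟦ b ⟧ ≤ ⟦ a ∨ b ⟧ + (⟦ a ∧ (b ∧ not e) ⟧ + ⟦ e ⟧)
  ⟦⟧-modular true  true  true  = ≤-refl
  ⟦⟧-modular true  true  false = ≤-refl
  ⟦⟧-modular true  false _     = m≤m+n _ _
  ⟦⟧-modular false b     e     = m≤m+n _ _

  -- The `1` pays for `x`, which is taken out of the intersection.
  union : count A₁ + count A₂ ≤ count C + (count D + 1)
  union = subst (λ s → count A₁ + count A₂ ≤ count C + s)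
    (trans (∑-distrib-+ (λ z → ⟦ D z ⟧) _) (cong (count D +_) (count-single x)))
    (sum-+-mono (λ z → ⟦⟧-modular (A₁ z) (A₂ z) ⌊ z ≟ x ⌋))

  -- The two deficiencies contribute 2 and the removal of `x` costs 1, so a surplus of 1 is left for
  -- `C` and `D` together.
  total : suc (count (nbhd R C) + count (nbhd R D)) ≤ count C + count D
  total = ≤-pred (begin
    suc (suc (count (nbhd R C) + count (nbhd R D)))
      ≤⟨ s≤s (s≤s (sum-+-mono (λ y → ⟦⟧-submodular (both y) (either y)))) ⟩
    suc (suc (count (nbhd R₁ A₁) + count (nbhd R₂ A₂)))
      ≡⟨ cong suc (sym (+-suc _ _)) ⟩
    suc (count (nbhd R₁ A₁)) + suc (count (nbhd R₂ A₂)) ≤⟨ +-mono-≤ def₁ def₂ ⟩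
    count A₁ + count A₂                                 ≤⟨ union ⟩
    count C + (count D + 1)                             ≡⟨ shift (count C) (count D) ⟩
    suc (count C + count D) ∎)
    where
    open ≤-Reasoning
    shift : ∀ c d → c + (d + 1) ≡ suc (c + d)
    shift = solve-∀

  result : ∃ (Deficient R)
  result with count (nbhd R C) <? count C
  ... | yes lt = C , lt
  ... | no ¬lt = D , +-cancelˡ-< (count C) _ _
          (≤-trans (s≤s (+-monoˡ-≤ _ (≮⇒≥ ¬lt))) total)

module _ (R : Graph m) (functional : ∀ {x y₁ y₂} → R x y₁ ≡ true → R x y₂ ≡ true → y₁ ≡ y₂) where

  -- Base case: every left vertex has at most one edge. A failure of totality, surjectivity or
  -- injectivity makes a singleton, the full set or a pair deficient. Testing collisions directly
  -- replaces a pigeonhole argument.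
  functional-hall : Matching R ⊎ ∃ (Deficient R)
  functional-hall with all? (λ x → any? (λ y → R x y ≟ᵇ true))
  ... | no ¬total = inj₂ (single , <-≤-trans (s≤s isolated) (1≤count single (isYes-true (x ≟ x) refl)))
    where
    missing = ¬∀⟶∃¬ m _ (λ x → any? (λ y → R x y ≟ᵇ true)) ¬total
    x = proj₁ missing
    single : Fin m → Bool
    single z = ⌊ z ≟ x ⌋
    isolated : count (nbhd R single) ≤ 0
    isolated = ≤-trans (count-mono {Q = λ _ → false} λ y h → ⊥-elim (absurd y h)) (≤-reflexive (sum-replicate-zero m))
      where
      absurd : ∀ y → nbhd R single y ≡ true → ⊥
      absurd y h with nbhd-elim R single h
      ... | z , z≡x , Rzy = proj₂ missing (y , subst (λ u → R u y ≡ true) (true-isYes (z ≟ x) z≡x) Rzy)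
  ... | yes total with all? (λ y → any? (λ x → R x y ≟ᵇ true))
  ...   | no ¬onto = inj₂ ((λ _ → true) , ≤-<-trans (count-mono avoids) (count-∖-≤ (λ _ → true) {y} refl))
    where
    missing = ¬∀⟶∃¬ m _ (λ y → any? (λ x → R x y ≟ᵇ true)) ¬onto
    y = proj₁ missing
    avoids : ∀ z → nbhd R (λ _ → true) z ≡ true → ((λ _ → true) ∖ y) z ≡ true
    avoids z h with nbhd-elim R (λ _ → true) h
    ... | x , _ , Rxz = ∖-intro (λ _ → true) {y} {z} refl λ { refl → proj₂ missing (x , Rxz) }
  ...   | yes onto with any? (λ x → any? (λ x′ → ¬? (x′ ≟ x) ×-dec (proj₁ (total x′) ≟ proj₁ (total x))))
  ...     | yes (x , x′ , x′≢x , same) = inj₂ (pair , ≤-<-trans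
              (≤-trans (count-mono inside) (≤-reflexive (count-single (proj₁ (total x)))))
              (2≤count pair (∨-introˡ (isYes-true (x ≟ x) refl)) (∨-introʳ (isYes-true (x′ ≟ x′) refl)) x′≢x))
    where
    pair : Fin m → Bool
    pair z = ⌊ z ≟ x ⌋ ∨ ⌊ z ≟ x′ ⌋
    inside : ∀ y → nbhd R pair y ≡ true → ⌊ y ≟ proj₁ (total x) ⌋ ≡ true
    inside y h with nbhd-elim R pair h
    ... | z , z∈pair , Rzy with ∨-elim z∈pair
    ...   | inj₁ p with true-isYes (z ≟ x) p
    ...     | refl = isYes-true (y ≟ _) (functional Rzy (proj₂ (total x)))
    inside y h | z , z∈pair , Rzy | inj₂ p with true-isYes (z ≟ x′) p
    ...     | refl = isYes-true (y ≟ _) (trans (functional Rzy (proj₂ (total x′))) same)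
  functional-hall | yes total | yes onto | no ¬collision = inj₁ record
    { to      = λ x → proj₁ (total x)
    ; from    = λ y → proj₁ (onto y)
    ; edge    = λ x → proj₂ (total x)
    ; to-from = to-from
    ; from-to = λ x → injective _ _ (to-from (proj₁ (total x)))
    }
    where
    to-from : ∀ y → proj₁ (total (proj₁ (onto y))) ≡ y
    to-from y = functional (proj₂ (total _)) (proj₂ (onto y))
    injective : ∀ x′ x → proj₁ (total x′) ≡ proj₁ (total x) → x′ ≡ x
    injective x′ x eq with x′ ≟ x
    ... | yes p = p
    ... | no ¬p = contradiction (x , x′ , ¬p , eq) ¬collision

-- Induction on the number of edges. While some `x` has two edges, each is deleted in turn: a
-- matching of either smaller graph is one of `R`, and two deficient sets are merged by
-- `deficient-delete`.
hall : (R : Graph m) → Matching R ⊎ ∃ (Deficient R)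
hall R = go (suc (edges R)) R ≤-refl
  where
  go : ∀ k (R : Graph m) → edges R < k → Matching R ⊎ ∃ (Deficient R)
  go (suc k) R (s≤s le)
    with any? (λ x → any? (λ y₁ → any? (λ y₂ → (R x y₁ ≟ᵇ true) ×-dec (R x y₂ ≟ᵇ true) ×-dec ¬? (y₁ ≟ y₂))))
  ... | no ¬branch = functional-hall R functional
    where
    functional : ∀ {x y₁ y₂} → R x y₁ ≡ true → R x y₂ ≡ true → y₁ ≡ y₂
    functional {x} {y₁} {y₂} p q with y₁ ≟ y₂
    ... | yes e = e
    ... | no ¬e = contradiction (x , y₁ , y₂ , p , q , ¬e) ¬branch
  ... | yes (x , y₁ , y₂ , Rxy₁ , Rxy₂ , y₁≢y₂)
    with go k (delete R x y₁) (<-≤-trans (edges-delete R Rxy₁) le)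
       | go k (delete R x y₂) (<-≤-trans (edges-delete R Rxy₂) le)
  ...   | inj₁ M | _ = inj₁ (restore M)
    where
    restore : Matching (delete R x y₁) → Matching R
    restore M = record { Matching M ; edge = λ u → ∧-conicalˡ (R u _) _ (Matching.edge M u) }
  ...   | inj₂ _ | inj₁ M = inj₁ (restore M)
    where
    restore : Matching (delete R x y₂) → Matching R
    restore M = record { Matching M ; edge = λ u → ∧-conicalˡ (R u _) _ (Matching.edge M u) }
  ...   | inj₂ d₁ | inj₂ d₂ = inj₂ (deficient-delete R y₁≢y₂ d₁ d₂)

-- Fractional perfect matchings

sumℚ-allFin : (g : Fin m → ℚ) → sumℚ (map g (allFin m)) ≡ Sumℚ.sum g
sumℚ-allFin {m} g = trans (cong sumℚ (map-tabulate (λ i → i) g)) (go g)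
  where
  go : ∀ {k} (g : Fin k → ℚ) → sumℚ (tabulate g) ≡ Sumℚ.sum g
  go {zero}  g = refl
  go {suc k} g = cong (g zero +ℚ_) (go (g ∘ suc))

half : Bool → ℚ
half b = if b then ½ else 0ℚ

sum-half-single : (x : Fin m) → Sumℚ.sum (λ i → half ⌊ i ≟ x ⌋) ≡ ½
sum-half-single {suc m} zero    = trans (cong (½ +ℚ_) (Sumℚ.sum-replicate-zero m)) (ℚ.+-identityʳ ½)
sum-half-single {suc m} (suc x) = trans (ℚ.+-identityˡ _) (trans
  (Sumℚ.sum-cong-≗ (λ i → cong half (trans (isYes≗does (suc i ≟ suc x)) (sym (isYes≗does (i ≟ x))))))
  (sum-half-single x))

Symmetric : Graph m → Set
Symmetric G = ∀ u v → G u v ≡ G v u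

alive-sym : {G : Graph m} → Symmetric G → (F : Fault m) → Symmetric (alive G F)
alive-sym G-sym F u v rewrite G-sym u v | ∨-comm (delE F u v) (delE F v u) with delV F u | delV F v
... | true  | true  = refl
... | true  | false = refl
... | false | true  = refl
... | false | false = refl

-- Deleted vertices get a loop, so that a perfect matching of the bipartite double
-- cover of G − F becomes a permutation of all of Fin m.
looped : Graph m → Fault m → Graph m
looped G F u v = alive G F u v ∨ (delV F u ∧ ⌊ v ≟ u ⌋)

looped-alive : (G : Graph m) (F : Fault m) {u v : Fin m} → delV F u ≡ false → looped G F u v ≡ true →
               alive G F u v ≡ true
looped-alive G F {u} {v} u∉F h with ∨-elim {alive G F u v} h
... | inj₁ p = p
... | inj₂ q = contradiction u∉F (true≢false (∧-conicalˡ (delV F u) _ q))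

module _ (G : Graph m) (G-sym : Symmetric G) (F : Fault m) where

  -- Each arc from `v` to `to v` puts ½ on its edge. Among surviving vertices, longer cycles of the
  -- permutation carry ½ on every edge and 2-cycles carry 1, so `v` receives ½ through `to v` and ½
  -- through `from v`.
  matching⇒fractional : Matching (looped G F) → FracPerfectMatching G F
  matching⇒fractional M = record
    { f       = f
    ; symm    = λ u v _ → ℚ.+-comm (half ⌊ to u ≟ v ⌋) (half ⌊ to v ≟ u ⌋)
    ; lower   = λ u v _ → lower ⌊ to u ≟ v ⌋ ⌊ to v ≟ u ⌋
    ; upper   = λ u v _ → upper ⌊ to u ≟ v ⌋ ⌊ to v ≟ u ⌋
    ; perfect = perfect
    }
    where
    open Matching M
    f : Fin m → Fin m → ℚ
    f u v = half ⌊ to u ≟ v ⌋ +ℚ half ⌊ to v ≟ u ⌋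

    lower : ∀ a b → 0ℚ ≤ℚ half a +ℚ half b
    lower true  true  = toWitness {a? = 0ℚ ℚ.≤? _} _
    lower true  false = toWitness {a? = 0ℚ ℚ.≤? _} _
    lower false true  = toWitness {a? = 0ℚ ℚ.≤? _} _
    lower false false = toWitness {a? = 0ℚ ℚ.≤? _} _

    upper : ∀ a b → half a +ℚ half b ≤ℚ 1ℚ
    upper true  true  = toWitness {a? = _ ℚ.≤? 1ℚ} _
    upper true  false = toWitness {a? = _ ℚ.≤? 1ℚ} _
    upper false true  = toWitness {a? = _ ℚ.≤? 1ℚ} _
    upper false false = toWitness {a? = _ ℚ.≤? 1ℚ} _

    module _ (v : Fin m) (v∉F : delV F v ≡ false) where

      to-alive : alive G F v (to v) ≡ true
      to-alive = looped-alive G F v∉F (edge v)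

      from-alive : alive G F v (from v) ≡ true
      from-alive with ∨-elim {alive G F (from v) (to (from v))} (edge (from v))
      ... | inj₁ p = trans (alive-sym G-sym F v (from v)) (trans (cong (alive G F (from v)) (sym (to-from v))) p)
      -- If `from v` were matched by its loop, it would be `v` itself, and `v` would be deleted.
      ... | inj₂ q = contradiction v∉F (true≢false (trans (cong (delV F) v≡from) (∧-conicalˡ (delV F (from v)) _ q)))
        where
        v≡from : v ≡ from v
        v≡from = trans (sym (to-from v)) (true-isYes (_ ≟ _) (∧-conicalʳ (delV F (from v)) _ q))

      -- Both indicators vanish where the edge is not alive, because `to v` and `from v` are
      -- surviving neighbours of `v`. The inverse laws exchange `to u ≡ v` and `u ≡ from v`.
      term : ∀ u → (if alive G F v u then f v u else 0ℚ) ≡ half ⌊ u ≟ to v ⌋ +ℚ half ⌊ u ≟ from v ⌋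
      term u with to v ≟ u | to u ≟ v | u ≟ to v | u ≟ from v
      ... | yes p | _     | no ¬p | _     = contradiction (sym p) ¬p
      ... | no ¬p | _     | yes p | _     = contradiction (sym p) ¬p
      ... | _     | yes p | _     | no ¬p = contradiction (trans (sym (from-to u)) (cong from p)) ¬p
      ... | _     | no ¬p | _     | yes p = contradiction (trans (cong to p) (to-from v)) ¬p
      ... | yes refl | yes _ | yes _ | yes _ rewrite to-alive = refl
      ... | yes refl | no _  | yes _ | no _  rewrite to-alive = refl
      ... | no _ | yes _ | no _ | yes refl rewrite from-alive = refl
      ... | no _ | no _  | no _ | no _ with alive G F v u
      ...   | true  = refl
      ...   | false = refl

      perfect : sumℚ (map (λ u → if alive G F v u then f v u else 0ℚ) (allFin m)) ≡ 1ℚ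
      perfect = begin
        sumℚ (map (λ u → if alive G F v u then f v u else 0ℚ) (allFin m)) ≡⟨ sumℚ-allFin (λ u → if alive G F v u then f v u else 0ℚ) ⟩
        Sumℚ.sum (λ u → if alive G F v u then f v u else 0ℚ)              ≡⟨ Sumℚ.sum-cong-≗ term ⟩
        Sumℚ.sum (λ u → half ⌊ u ≟ to v ⌋ +ℚ half ⌊ u ≟ from v ⌋)         ≡⟨ Sumℚ.∑-distrib-+ (λ u → half ⌊ u ≟ to v ⌋) _ ⟩
        Sumℚ.sum (λ u → half ⌊ u ≟ to v ⌋) +ℚ Sumℚ.sum (λ u → half ⌊ u ≟ from v ⌋)
          ≡⟨ cong₂ _+ℚ_ (sum-half-single (to v)) (sum-half-single (from v)) ⟩
        1ℚ ∎
        where open ≡-Reasoning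

  record Obstruction : Set where
    field
      I           : Fin m → Bool
      survives    : ∀ x → I x ≡ true → delV F x ≡ false
      independent : ∀ x y → I x ≡ true → I y ≡ true → alive G F x y ≡ false
      deficient   : Deficient (alive G F) I

  -- From a deficient set A, the set A ∖ N(A) is deficient and independent; it contains
  -- no deleted vertex because those have loops.
  deficient⇒obstruction : ∃ (Deficient (looped G F)) → Obstruction
  deficient⇒obstruction (A , def) = record
    { I           = I
    ; survives    = survives
    ; independent = λ x y Ix Iy → ¬-not (not-alive x y Ix (I⇒A y Iy))
    -- The chain is |A| + |N(I)| ≤ |I| + |N(A)| < |I| + |A|, with N(I) taken in G - F and N(A) in
    -- the looped graph; then |A| is cancelled.
    ; deficient   = +-cancelʳ-< (count A) _ _
        (subst₂ _<_ (+-comm (count A) _) refl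
          (≤-<-trans (sum-+-mono pointwise) (+-monoʳ-< (count I) def)))
    }
    where
    N I : Fin m → Bool
    N = nbhd (looped G F) A
    I x = A x ∧ not (N x)

    I⇒A : ∀ x → I x ≡ true → A x ≡ true
    I⇒A x = ∧-conicalˡ (A x) _

    I⇒¬N : ∀ x → I x ≡ true → N x ≡ false
    I⇒¬N x Ix = not-true (∧-conicalʳ (A x) _ Ix)

    survives : ∀ x → I x ≡ true → delV F x ≡ false
    survives x Ix = ¬-not λ x∈F → contradiction (I⇒¬N x Ix) (true≢false (nbhd-intro (looped G F) A (I⇒A x Ix)
      (∨-introʳ (∧-intro x∈F (isYes-true (x ≟ x) refl)))))

    not-alive : ∀ x y → I x ≡ true → A y ≡ true → alive G F x y ≢ true
    not-alive x y Ix Ay xy = true≢false (nbhd-intro (looped G F) A Ay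
      (∨-introˡ (trans (alive-sym G-sym F y x) xy))) (I⇒¬N x Ix)

    N-I : ∀ y → nbhd (alive G F) I y ≡ true → N y ≡ true × A y ≡ false
    N-I y h with nbhd-elim (alive G F) I h
    ... | x , Ix , xy = nbhd-intro (looped G F) A (I⇒A x Ix) (∨-introˡ xy)
                      , ¬-not (λ Ay → not-alive x y Ix Ay xy)

    -- A surviving neighbour of `I` lies in `N` but not in `A`, and a member of `A` outside `I` lies
    -- in `N`.
    pointwise : ∀ y → ⟦ A y ⟧ + ⟦ nbhd (alive G F) I y ⟧ ≤ ⟦ I y ⟧ + ⟦ N y ⟧
    pointwise y with nbhd (alive G F) I y in eq
    ... | true with N-I y eq
    ...   | Ny , ¬Ay rewrite Ny | ¬Ay = ≤-refl
    pointwise y | false with A y | N y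
    ...   | true  | true  = ≤-refl
    ...   | true  | false = ≤-refl
    ...   | false | _     = z≤n

  FSMP⇒obstruction : IsFSMP G F → Obstruction
  FSMP⇒obstruction ¬fpm with hall (looped G F)
  ... | inj₁ M = contradiction (matching⇒fractional M) ¬fpm
  ... | inj₂ d = deficient⇒obstruction d

-- Counting faults

countB-tabulate : (P : Fin m → Bool) → countB (tabulate P) ≡ count P
countB-tabulate {zero}  P = refl
countB-tabulate {suc m} P with P zero
... | true  = cong suc (countB-tabulate (P ∘ suc))
... | false = countB-tabulate (P ∘ suc)

countB-allFin : (P : Fin m → Bool) → countB (map P (allFin m)) ≡ count P
countB-allFin P = trans (cong countB (map-tabulate (λ i → i) P)) (countB-tabulate P)

countB-++ : ∀ as bs → countB (as ++ bs) ≡ countB as + countB bs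
countB-++ []           bs = refl
countB-++ (true  ∷ as) bs = cong suc (countB-++ as bs)
countB-++ (false ∷ as) bs = countB-++ as bs

-- Stated for `tabulate h` with arbitrary `h`, because the induction replaces `h` by `h ∘ suc`.
countB-concatMap : ∀ {k} (g : Fin m → List Bool) (h : Fin k → Fin m) →
                   countB (concatMap g (tabulate h)) ≡ sum (λ i → countB (g (h i)))
countB-concatMap {k = zero}  g h = refl
countB-concatMap {k = suc k} g h = trans (countB-++ (g (h zero)) _)
  (cong (countB (g (h zero)) +_) (countB-concatMap g (h ∘ suc)))

faultyEdge : Graph m → Fault m → Graph m
faultyEdge G F i j = G i j ∧ (delE F i j ∨ delE F j i)

size-count : (G : Graph m) (F : Fault m) →
             size G F ≡ count (delV F) + edges (λ i j → (toℕ i <ᵇ toℕ j) ∧ faultyEdge G F i j)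
size-count {m} G F = cong₂ _+_ (countB-allFin (delV F))
  (trans (countB-concatMap (λ i → map (O i) (allFin m)) (λ i → i)) (sum-cong-≗ (λ i → countB-allFin (O i))))
  where
  O : Graph m
  O i j = (toℕ i <ᵇ toℕ j) ∧ faultyEdge G F i j

sum₂-mono : {f g : Fin m → Fin m → ℕ} → (∀ i j → f i j ≤ g i j) →
            sum (λ i → sum (f i)) ≤ sum (λ i → sum (g i))
sum₂-mono h = sum-mono (λ i → sum-mono (h i))

sum₂-distrib-+ : (f g : Fin m → Fin m → ℕ) →
                 sum (λ i → sum (λ j → f i j + g i j)) ≡ sum (λ i → sum (f i)) + sum (λ i → sum (g i))
sum₂-distrib-+ f g = trans (sum-cong-≗ (λ i → ∑-distrib-+ (f i) (g i))) (∑-distrib-+ (λ i → sum (f i)) _)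

-- Inner edges and boundary of a vertex set

inner : Graph m → (Fin m → Bool) → Graph m
inner G P i j = P i ∧ P j ∧ G i j

boundary : Graph m → (Fin m → Bool) → Fin m → Bool
boundary G P y = not (P y) ∧ nbhd G P y

-- Ordered pairs of adjacent vertices are counted, so the weight is 2 (e(P) + |∂P|).
weight : Graph m → (Fin m → Bool) → ℕ
weight G P = edges (inner G P) + 2 * count (boundary G P)

Loopless : Graph m → Set
Loopless G = ∀ v → G v v ≡ false

module _ (G : Graph m) (G-sym : Symmetric G) (loopless : Loopless G) (F : Fault m) where

  private
    S : Graph m
    S = faultyEdge G F

    S-sym : Symmetric S
    S-sym i j rewrite G-sym i j | ∨-comm (delE F i j) (delE F j i) = refl

    O : Graph m
    O i j = (toℕ i <ᵇ toℕ j) ∧ S i j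

  -- `size` counts a faulty edge once, smaller endpoint first, whereas `edges` counts both orders;
  -- looplessness disposes of the diagonal.
  edges-faulty : edges S ≤ edges O + edges O
  edges-faulty = ≤-trans
    (sum₂-mono (λ i j → ⟦⟧-∨ {S i j} {O i j} {O j i} (split i j)))
    (≤-reflexive (trans (sum₂-distrib-+ (λ i j → ⟦ O i j ⟧) (λ i j → ⟦ O j i ⟧))
      (cong (edges O +_) (∑-comm (λ i j → ⟦ O j i ⟧)))))
    where
    split : ∀ i j → S i j ≡ true → O i j ≡ true ⊎ O j i ≡ true
    split i j Sij with <-cmp (toℕ i) (toℕ j)
    ... | tri< lt _ _ = inj₁ (∧-intro (Equivalence.to T-≡ (<⇒<ᵇ lt)) Sij)
    ... | tri> _ _ gt = inj₂ (∧-intro (Equivalence.to T-≡ (<⇒<ᵇ gt)) (trans (S-sym j i) Sij))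
    ... | tri≈ _ eq _ with toℕ-injective eq
    ...   | refl = contradiction (loopless i) (true≢false (∧-conicalˡ (G i i) _ Sij))

  -- The estimate for e(I) + |∂I| is doubled so that ordered pairs can be counted without halving.
  -- The `+ 2` is the strictness of `deficient`, doubled.
  weight≤faults : (ob : Obstruction G G-sym F) → let open Obstruction ob in
                  weight G I + 2 ≤ (size G F + size G F) + (count I + count I)
  weight≤faults ob = begin
    edges (inner G I) + 2 * B + 2
      ≤⟨ +-monoˡ-≤ 2 (+-monoʳ-≤ (edges (inner G I)) (*-monoʳ-≤ 2 boundary≤)) ⟩
    edges (inner G I) + 2 * (V + (N + E)) + 2
      ≡⟨ shuffle (edges (inner G I)) V N E ⟩
    (edges (inner G I) + (E + E)) + (V + V) + (suc N + suc N)
      ≤⟨ +-mono-≤ (+-monoˡ-≤ (V + V) (≤-trans inner≤ edges-faulty)) (+-mono-≤ deficient deficient) ⟩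
    (edges O + edges O) + (V + V) + (count I + count I)
      ≡⟨ shuffle′ (edges O) V (count I) ⟩
    (V + edges O) + (V + edges O) + (count I + count I)
      ≡⟨ cong (λ s → s + s + (count I + count I)) (sym (size-count G F)) ⟩
    (size G F + size G F) + (count I + count I) ∎
    where
    open ≤-Reasoning
    open Obstruction ob

    -- Faulty edges leaving `I`, oriented outwards, so that each is counted once.
    Q : Graph m
    Q i j = I i ∧ not (I j) ∧ S i j

    B V N E : ℕ
    B = count (boundary G I)
    V = count (delV F)
    N = count (nbhd (alive G F) I)
    E = edges Q

    shuffle : ∀ a v n e → a + 2 * (v + (n + e)) + 2 ≡ (a + (e + e)) + (v + v) + (suc n + suc n)
    shuffle = solve-∀
    shuffle′ : ∀ o v i → (o + o) + (v + v) + (i + i) ≡ (v + o) + (v + o) + (i + i)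
    shuffle′ = solve-∀

    classify : ∀ i j → I i ≡ true → delV F j ≡ false → G i j ≡ true → alive G F i j ≡ true ⊎ S i j ≡ true
    classify i j Ii j∉F Gij rewrite survives i Ii | j∉F | Gij with delE F i j ∨ delE F j i
    ... | true  = inj₂ refl
    ... | false = inj₁ refl

    inner⇒S : ∀ i j → I i ≡ true → I j ≡ true → G i j ≡ true → S i j ≡ true
    inner⇒S i j Ii Ij Gij with classify i j Ii (survives j Ij) Gij
    ... | inj₁ p = contradiction (independent i j Ii Ij) (true≢false p)
    ... | inj₂ q = q

    -- Pairs inside `I`, pairs leaving `I` and pairs entering `I` are disjoint kinds of ordered
    -- faulty pairs, so no faulty edge is charged twice.
    inner≤ : edges (inner G I) + (E + E) ≤ edges S
    inner≤ = ≤-trans (≤-reflexive (trans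
        (cong (λ s → edges (inner G I) + (E + s)) (∑-comm (λ i j → ⟦ Q i j ⟧)))
        (sym (trans (sum₂-distrib-+ (λ i j → ⟦ inner G I i j ⟧) _)
          (cong (edges (inner G I) +_) (sum₂-distrib-+ (λ i j → ⟦ Q i j ⟧) (λ i j → ⟦ Q j i ⟧)))))))
      (sum₂-mono pointwise)
      where
      pointwise : ∀ i j → ⟦ inner G I i j ⟧ + (⟦ Q i j ⟧ + ⟦ Q j i ⟧) ≤ ⟦ S i j ⟧
      pointwise i j with I i in Ii | I j in Ij
      ... | true  | true  rewrite +-identityʳ ⟦ G i j ⟧ = ⟦⟧-mono (inner⇒S i j Ii Ij)
      ... | true  | false rewrite +-identityʳ ⟦ S i j ⟧ = ≤-refl
      ... | false | true  = ≤-reflexive (cong ⟦_⟧ (S-sym j i))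
      ... | false | false = z≤n

    -- A boundary vertex that is not deleted has a neighbour in `I`, and the edge between them is
    -- either alive or counted by `Q`.
    boundary≤ : B ≤ V + (N + E)
    boundary≤ = ≤-trans (sum-mono pointwise) (≤-reflexive (trans (∑-distrib-+ (λ j → ⟦ delV F j ⟧) _)
      (cong (V +_) (trans (∑-distrib-+ (λ j → ⟦ nbhd (alive G F) I j ⟧) _)
        (cong (N +_) (∑-comm (λ j i → ⟦ Q i j ⟧)))))))
      where
      pointwise : ∀ j → ⟦ boundary G I j ⟧ ≤ ⟦ delV F j ⟧ + (⟦ nbhd (alive G F) I j ⟧ + count (λ i → Q i j))
      pointwise j with boundary G I j in eq
      ... | false = z≤n
      ... | true = faulty (delV F j) refl
        where
        faulty : ∀ b → delV F j ≡ b → 1 ≤ ⟦ b ⟧ + (⟦ nbhd (alive G F) I j ⟧ + count (λ i → Q i j))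
        faulty true  _   = s≤s z≤n
        faulty false j∉F with nbhd-elim G I (∧-conicalʳ (not (I j)) _ eq)
        ... | i , Ii , Gij with classify i j Ii j∉F Gij
        ...   | inj₁ p = ≤-trans (⟦⟧-mono {true} (λ _ → nbhd-intro (alive G F) I Ii p)) (m≤m+n _ _)
        ...   | inj₂ q = ≤-trans (1≤count (λ i → Q i j) {i}
                  (∧-intro Ii (∧-intro (∧-conicalˡ (not (I j)) _ eq) q))) (m≤n+m _ _)

-- Expansion

-- For r = 6 ∸ 2 k this is e(P) + |∂P| ≥ |P| + 2 n − 3 + k, doubled.
Expanding : (n k r : ℕ) → Graph m → Set
Expanding n k r G = ∀ P → k ≤ count P → 4 * n + 2 * count P ≤ weight G P + r

-- The invariant preserved by joins and isomorphisms. The degree is 2n - 1, written without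
-- truncated subtraction; `vertex` is where the minimum degree is attained.
record Cube (n : ℕ) (G : Graph m) : Set where
  field
    vertex    : Fin m
    symmetric : Symmetric G
    loopless  : Loopless G
    regular   : ∀ v → suc (count (G v)) ≡ n + n
    expanding : Expanding n 1 4 G

-- Closure under isomorphism

module _ {G H : Graph m} (G≅H : G ≅ H) where

  private
    σ = proj₁ G≅H
    σʳ : Fin m → Fin m
    σʳ = σ ⟨$⟩ʳ_
    preserves = proj₂ G≅H

    onto : {A : Fin m → Set} → (∀ u → A (σʳ u)) → ∀ v → A v
    onto {A = A} h v = subst A (inverseʳ σ) (h (σ ⟨$⟩ˡ v))

  count-permute : (P : Fin m → Bool) → count P ≡ count (P ∘ σʳ)
  count-permute P = sum-permute (λ i → ⟦ P i ⟧) σ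

  -- An inequality is enough for `Expanding-iso`, so the boundary is transported in one direction
  -- only.
  weight-permute : (P : Fin m → Bool) → weight G (P ∘ σʳ) ≤ weight H P
  weight-permute P = +-mono-≤ (≤-reflexive inner≡) (*-monoʳ-≤ 2 boundary≤)
    where
    inner≡ : edges (inner G (P ∘ σʳ)) ≡ edges (inner H P)
    inner≡ = sym (trans (sum-permute (λ i → count (inner H P i)) σ) (sum-cong-≗ λ i →
      trans (sum-permute (λ j → ⟦ inner H P (σʳ i) j ⟧) σ)
        (sum-cong-≗ λ j → cong (λ b → ⟦ P (σʳ i) ∧ P (σʳ j) ∧ b ⟧) (preserves i j))))

    boundary-mono : ∀ y → boundary G (P ∘ σʳ) y ≡ true → boundary H P (σʳ y) ≡ true
    boundary-mono y h with nbhd-elim G (P ∘ σʳ) (∧-conicalʳ (not (P (σʳ y))) _ h)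
    ... | x , Px , Gxy = ∧-intro (∧-conicalˡ _ _ h) (nbhd-intro H P Px (trans (preserves x y) Gxy))

    boundary≤ : count (boundary G (P ∘ σʳ)) ≤ count (boundary H P)
    boundary≤ = subst (count (boundary G (P ∘ σʳ)) ≤_) (sym (count-permute (boundary H P)))
      (count-mono boundary-mono)

  Expanding-iso : ∀ {n k r} → Expanding n k r G → Expanding n k r H
  Expanding-iso {n} {k} {r} expanding P ne = begin
    4 * n + 2 * count P          ≡⟨ cong (λ c → 4 * n + 2 * c) (count-permute P) ⟩
    4 * n + 2 * count (P ∘ σʳ)   ≤⟨ expanding (P ∘ σʳ) (subst (k ≤_) (count-permute P) ne) ⟩
    weight G (P ∘ σʳ) + r        ≤⟨ +-monoˡ-≤ r (weight-permute P) ⟩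
    weight H P + r ∎
    where open ≤-Reasoning

  Cube-iso : Cube n G → Cube n H
  Cube-iso {n} C = record
    { vertex    = σʳ vertex
    ; symmetric = onto λ u → onto λ v → trans (preserves u v) (trans (symmetric u v) (sym (preserves v u)))
    ; loopless  = onto λ u → trans (preserves u u) (loopless u)
    ; regular   = onto λ u → trans
        (cong suc (trans (count-permute (H (σʳ u))) (sum-cong-≗ λ v → cong ⟦_⟧ (preserves u v)))) (regular u)
    ; expanding = Expanding-iso {n} expanding
    }
    where open Cube C

-- Strong matching preclusion

module _ {G : Graph m} (C : Cube n G) where
  open Cube C

  private
    d : ℕ
    d = count (G vertex)

    suc-d : suc d ≡ n + n
    suc-d = regular vertex

    neighbours : Fault m
    neighbours = fault (G vertex) (λ _ _ → false)

  size-neighbours : size G neighbours ≡ d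
  size-neighbours = trans (size-count G neighbours) (trans (cong (d +_) no-edges) (+-identityʳ d))
    where
    no-edges : edges (λ i j → (toℕ i <ᵇ toℕ j) ∧ faultyEdge G neighbours i j) ≡ 0
    no-edges = trans
      (sum-cong-≗ λ i → trans (sum-cong-≗ λ j → cong ⟦_⟧ (false-edge (toℕ i <ᵇ toℕ j) (G i j)))
        (sum-replicate-zero m))
      (sum-replicate-zero m)
      where
      false-edge : ∀ a b → a ∧ (b ∧ false) ≡ false
      false-edge false _     = refl
      false-edge true  false = refl
      false-edge true  true  = refl

  -- `vertex` survives, having no loop, but all its neighbours are deleted, so the weights at it sum
  -- to 0 and not to 1. This bounds the preclusion number above by `d`.
  neighbours-FSMP : IsFSMP G neighbours
  neighbours-FSMP M = 0≢1 (trans (sym zero-sum) (perfect vertex (loopless vertex)))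
    where
    open FracPerfectMatching M
    0≢1 : 0ℚ ≢ 1ℚ
    0≢1 ()
    dead : ∀ u → alive G neighbours vertex u ≡ false
    dead u rewrite loopless vertex with G vertex u
    ... | true  = refl
    ... | false = refl
    zero-sum : sumℚ (map (λ u → if alive G neighbours vertex u then f vertex u else 0ℚ) (allFin m)) ≡ 0ℚ
    zero-sum = trans (sumℚ-allFin (λ u → if alive G neighbours vertex u then f vertex u else 0ℚ))
      (trans (Sumℚ.sum-cong-≗ λ u → cong (λ b → if b then f vertex u else 0ℚ) (dead u)) (Sumℚ.sum-replicate-zero m))

  module _ (F : Fault m) (fsmp : IsFSMP G F) where

    private
      ob : Obstruction G symmetric F
      ob = FSMP⇒obstruction G symmetric F fsmp
      open Obstruction ob renaming (I to P)
      nonempty : 1 ≤ count P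
      nonempty = ≤-trans (s≤s z≤n) deficient
      s : ℕ
      s = size G F

      -- Here `k` is a loss and not the cardinality threshold of `Expanding`: the constants 4 and 2
      -- correspond to `k = 1` and `k = 0`, giving |F| ≥ 2n - 1 and |F| ≥ 2n.
      bound : ∀ k → 4 * n + 2 * count P ≤ weight G P + (2 + (k + k)) → n + n ≤ k + s
      bound k h = *-cancelˡ-≤ 2 (+-cancelʳ-≤ (2 * count P) _ _ (begin
        2 * (n + n) + 2 * count P               ≡⟨ lhs n (count P) ⟩
        4 * n + 2 * count P                     ≤⟨ h ⟩
        weight G P + (2 + (k + k))              ≡⟨ sym (+-assoc (weight G P) 2 (k + k)) ⟩
        weight G P + 2 + (k + k)                ≤⟨ +-monoˡ-≤ (k + k) (weight≤faults G symmetric loopless F ob) ⟩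
        (s + s) + (count P + count P) + (k + k) ≡⟨ rhs s (count P) k ⟩
        2 * (k + s) + 2 * count P ∎))
        where
        open ≤-Reasoning
        lhs : ∀ n c → 2 * (n + n) + 2 * c ≡ 4 * n + 2 * c
        lhs = solve-∀
        rhs : ∀ s c k → (s + s) + (c + c) + (k + k) ≡ 2 * (k + s) + 2 * c
        rhs = solve-∀

    d≤size : d ≤ size G F
    d≤size = ≤-pred (subst (_≤ suc s) (sym suc-d) (bound 1 (expanding P nonempty)))

    -- An obstruction with two or more vertices would force |F| ≥ 2n, beyond `d`, which is 2n - 1.
    -- So it is a single vertex, and deficiency leaves it no surviving neighbour.
    isolated : Expanding n 2 2 G → size G F ≤ d → HasIsolatedVertex G F
    isolated super s≤d with count P ≤? 1
    ... | no ≰1 = contradiction (≤-trans (subst (_≤ s) (sym suc-d) (bound 0 (super P (≰⇒> ≰1)))) s≤d)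
                    1+n≰n
    ... | yes ≤1 with count-positive P nonempty
    ...   | v , Pv = v , survives v Pv , λ u → ¬-not λ vu →
              contradiction (≤-trans (s≤s (1≤count (nbhd (alive G F) P) (nbhd-intro (alive G F) P Pv vu)))
                (≤-trans deficient ≤1)) 1+n≰n

  maximally-matched : FracStronglyMaximallyMatched G
  maximally-matched = d
    , ((neighbours , neighbours-FSMP , size-neighbours) , d≤size)
    , (vertex , countB-allFin (G vertex))
    , λ v → ≤-reflexive (trans (suc-injective (trans suc-d (sym (regular v))))
        (sym (countB-allFin (G v))))

  super-matched : Expanding n 2 2 G → FracStronglySuperMatched G
  super-matched super = maximally-matched , λ F optimal → isolated F (proj₁ optimal) super
    (subst (size G F ≤_) size-neighbours (proj₂ optimal neighbours neighbours-FSMP))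

-- Joining two graphs by two disjoint perfect matchings

count-zero : (P : Fin m → Bool) → count P ≡ 0 → ∀ x → P x ≡ false
count-zero P eq x = ¬-not λ Px → contradiction (subst (1 ≤_) eq (1≤count P Px)) λ ()

count-pair : {x y : Fin m} → x ≢ y → count (λ z → ⌊ z ≟ x ⌋ ∨ ⌊ z ≟ y ⌋) ≡ 2
count-pair {x = x} {y} x≢y = trans (sum-cong-≗ pointwise)
  (trans (∑-distrib-+ (λ z → ⟦ ⌊ z ≟ x ⌋ ⟧) _) (cong₂ _+_ (count-single x) (count-single y)))
  where
  pointwise : ∀ z → ⟦ ⌊ z ≟ x ⌋ ∨ ⌊ z ≟ y ⌋ ⟧ ≡ ⟦ ⌊ z ≟ x ⌋ ⟧ + ⟦ ⌊ z ≟ y ⌋ ⟧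
  pointwise z with z ≟ x | z ≟ y
  ... | yes p | yes q = contradiction (trans (sym p) q) x≢y
  ... | yes _ | no _  = refl
  ... | no _  | yes _ = refl
  ... | no _  | no _  = refl

split-elim : ∀ m {n} (A : Fin (m + n) → Set) → (∀ a → A (a ↑ˡ n)) → (∀ b → A (m ↑ʳ b)) → ∀ u → A u
split-elim m A left right u with splitAt m u in eq
... | inj₁ a = subst A (splitAt⁻¹-↑ˡ eq) (left a)
... | inj₂ b = subst A (splitAt⁻¹-↑ʳ eq) (right b)

Growing : ℕ → Graph m → Set
Growing k R = ∀ P → k ≤ count P → suc k ≤ count (nbhd R P)

module _ (G₁ G₂ : Graph m) (p q : Fin m → Fin m) where

  private
    J : Graph (m + m)
    J = join G₁ G₂ p q

  join-ˡˡ : ∀ a b → J (a ↑ˡ m) (b ↑ˡ m) ≡ G₁ a b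
  join-ˡˡ a b rewrite splitAt-↑ˡ m a m | splitAt-↑ˡ m b m = refl

  join-ˡʳ : ∀ a b → J (a ↑ˡ m) (m ↑ʳ b) ≡ cross p q a b
  join-ˡʳ a b rewrite splitAt-↑ˡ m a m | splitAt-↑ʳ m m b = refl

  join-ʳˡ : ∀ a b → J (m ↑ʳ a) (b ↑ˡ m) ≡ cross p q b a
  join-ʳˡ a b rewrite splitAt-↑ʳ m m a | splitAt-↑ˡ m b m = refl

  join-ʳʳ : ∀ a b → J (m ↑ʳ a) (m ↑ʳ b) ≡ G₂ a b
  join-ʳʳ a b rewrite splitAt-↑ʳ m m a | splitAt-↑ʳ m m b = refl

  module _ (P : Fin (m + m) → Bool) where

    private
      P₁ P₂ : Fin m → Bool
      P₁ a = P (a ↑ˡ m)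
      P₂ b = P (m ↑ʳ b)

    inner-join : edges (inner G₁ P₁) + edges (inner G₂ P₂) ≤ edges (inner J P)
    inner-join = ≤-trans (+-mono-≤ (sum-mono left) (sum-mono right))
      (≤-reflexive (sym (sum-++ m (λ i → count (inner J P i)))))
      where
      left : ∀ a → count (inner G₁ P₁ a) ≤ count (inner J P (a ↑ˡ m))
      left a = ≤-trans
        (≤-reflexive (sum-cong-≗ λ b → cong (λ e → ⟦ P₁ a ∧ P₁ b ∧ e ⟧) (sym (join-ˡˡ a b))))
        (≤-trans (m≤m+n _ _) (≤-reflexive (sym (sum-++ m (λ j → ⟦ inner J P (a ↑ˡ m) j ⟧)))))
      right : ∀ a → count (inner G₂ P₂ a) ≤ count (inner J P (m ↑ʳ a))
      right a = ≤-trans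
        (≤-reflexive (sum-cong-≗ λ b → cong (λ e → ⟦ P₂ a ∧ P₂ b ∧ e ⟧) (sym (join-ʳʳ a b))))
        (≤-trans (m≤n+m _ _) (≤-reflexive (sym (sum-++ m (λ j → ⟦ inner J P (m ↑ʳ a) j ⟧)))))

    boundary-ˡ : ∀ a → boundary G₁ P₁ a ≡ true → boundary J P (a ↑ˡ m) ≡ true
    boundary-ˡ a h with nbhd-elim G₁ P₁ (∧-conicalʳ (not (P₁ a)) _ h)
    ... | x , Px , e = ∧-intro (∧-conicalˡ _ _ h) (nbhd-intro J P Px (trans (join-ˡˡ x a) e))

    boundary-ʳ : ∀ b → boundary G₂ P₂ b ≡ true → boundary J P (m ↑ʳ b) ≡ true
    boundary-ʳ b h with nbhd-elim G₂ P₂ (∧-conicalʳ (not (P₂ b)) _ h)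
    ... | x , Px , e = ∧-intro (∧-conicalˡ _ _ h) (nbhd-intro J P Px (trans (join-ʳʳ x b) e))

    boundary-cross-ˡ : ∀ a → P₁ a ≡ false → nbhd (λ y x → cross p q x y) P₂ a ≡ true → boundary J P (a ↑ˡ m) ≡ true
    boundary-cross-ˡ a ¬Pa h with nbhd-elim (λ y x → cross p q x y) P₂ {a} h
    ... | y , Py , e = ∧-intro (cong not ¬Pa) (nbhd-intro J P Py (trans (join-ʳˡ y a) e))

    boundary-cross-ʳ : ∀ b → P₂ b ≡ false → nbhd (cross p q) P₁ b ≡ true → boundary J P (m ↑ʳ b) ≡ true
    boundary-cross-ʳ b ¬Pb h with nbhd-elim (cross p q) P₁ {b} h
    ... | x , Px , e = ∧-intro (cong not ¬Pb) (nbhd-intro J P Px (trans (join-ˡʳ x b) e))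

    weight-join-≥ : ∀ {a b} → a ≤ count (λ i → boundary J P (i ↑ˡ m)) → b ≤ count (λ i → boundary J P (m ↑ʳ i)) →
                    (edges (inner G₁ P₁) + edges (inner G₂ P₂)) + 2 * (a + b) ≤ weight J P
    weight-join-≥ {a} {b} a≤ b≤ = +-mono-≤ inner-join (*-monoʳ-≤ 2 a+b≤)
      where
      a+b≤ : a + b ≤ count (boundary J P)
      a+b≤ = ≤-trans (+-mono-≤ a≤ b≤) (≤-reflexive (sym (sum-++ m (λ i → ⟦ boundary J P i ⟧))))

    -- A lower bound suffices, so matching edges inside `P` and boundary vertices reached only
    -- through matching edges are discarded.
    weight-join : weight G₁ P₁ + weight G₂ P₂ ≤ weight J P
    weight-join = ≤-trans (≤-reflexive (shuffle (edges (inner G₁ P₁)) _ (count (boundary G₁ P₁)) _))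
      (weight-join-≥ (count-mono boundary-ˡ) (count-mono boundary-ʳ))
      where
      shuffle : ∀ e f a b → (e + 2 * a) + (f + 2 * b) ≡ (e + f) + 2 * (a + b)
      shuffle = solve-∀

    -- When `P` misses the right half, everything the matchings reach there is boundary, in addition
    -- to the boundary inside the left half.
    weight-join-ˡ : (∀ b → P₂ b ≡ false) → weight G₁ P₁ + 2 * count (nbhd (cross p q) P₁) ≤ weight J P
    weight-join-ˡ P₂-empty = ≤-trans
      (≤-trans (≤-reflexive (shuffle e a b)) (+-monoˡ-≤ _ (m≤m+n e (edges (inner G₂ P₂)))))
      (weight-join-≥ (count-mono boundary-ˡ) (count-mono λ i → boundary-cross-ʳ i (P₂-empty i)))
      where
      e a b : ℕ
      e = edges (inner G₁ P₁)
      a = count (boundary G₁ P₁)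
      b = count (nbhd (cross p q) P₁)
      shuffle : ∀ e a b → (e + 2 * a) + 2 * b ≡ e + 2 * (a + b)
      shuffle = solve-∀

    weight-join-ʳ : (∀ a → P₁ a ≡ false) → weight G₂ P₂ + 2 * count (nbhd (λ y x → cross p q x y) P₂) ≤ weight J P
    weight-join-ʳ P₁-empty = ≤-trans
      (≤-trans (≤-reflexive (shuffle f a b)) (+-monoˡ-≤ _ (m≤n+m f (edges (inner G₁ P₁)))))
      (weight-join-≥ (count-mono λ i → boundary-cross-ˡ i (P₁-empty i)) (count-mono boundary-ʳ))
      where
      f a b : ℕ
      f = edges (inner G₂ P₂)
      a = count (nbhd (λ y x → cross p q x y) P₂)
      b = count (boundary G₂ P₂)
      shuffle : ∀ f a b → (f + 2 * b) + 2 * a ≡ f + 2 * (a + b)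
      shuffle = solve-∀

  -- The equation on `r` balances a set within one half: passing from `n` to `suc n` demands 4 more,
  -- the bound for the half has slack 4, and `suc k` cross neighbours contribute `2 * suc k`. It is
  -- applied with `k = 1`, `r = 4` and with `k = 2`, `r = 2`.
  Expanding-join : ∀ {n} k r → 1 ≤ k → 2 * suc k + r ≡ 8 → 4 ≤ n →
                   Growing k (cross p q) → Growing k (λ y x → cross p q x y) →
                   Expanding n 1 4 G₁ → Expanding n 1 4 G₂ → Expanding (suc n) k r J
  Expanding-join {n} k r 1≤k kr 4≤n growˡ growʳ exp₁ exp₂ P k≤c =
    cases (count P₁) (count P₂) refl refl
    where
    open ≤-Reasoning
    P₁ P₂ : Fin m → Bool
    P₁ a = P (a ↑ˡ m)
    P₂ b = P (m ↑ʳ b)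

    count-join : count P ≡ count P₁ + count P₂
    count-join = sum-++ m (λ i → ⟦ P i ⟧)

    one-sided : ∀ {c w N} → suc k ≤ N → 4 * n + 2 * c ≤ w + 4 → w + 2 * N ≤ weight J P → count P ≡ c →
                4 * suc n + 2 * count P ≤ weight J P + r
    one-sided {c} {w} {N} k<N exp w≤ refl = +-cancelʳ-≤ (2 * suc k) _ _ (begin
      4 * suc n + 2 * c + 2 * suc k ≡⟨ lhs n c (2 * suc k) ⟩
      4 * n + 2 * c + (4 + 2 * suc k) ≤⟨ +-mono-≤ exp (+-monoʳ-≤ 4 (*-monoʳ-≤ 2 k<N)) ⟩
      w + 4 + (4 + 2 * N)           ≡⟨ mid w N ⟩
      w + 2 * N + 8                 ≤⟨ +-monoˡ-≤ 8 w≤ ⟩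
      weight J P + 8                ≡⟨ cong (weight J P +_) (trans (sym kr) (+-comm _ r)) ⟩
      weight J P + (r + 2 * suc k)  ≡⟨ sym (+-assoc (weight J P) r _) ⟩
      weight J P + r + 2 * suc k ∎)
      where
      lhs : ∀ n c s → 4 * suc n + 2 * c + s ≡ 4 * n + 2 * c + (4 + s)
      lhs = solve-∀
      mid : ∀ w N → w + 4 + (4 + 2 * N) ≡ w + 2 * N + 8
      mid = solve-∀

    cases : ∀ c₁ c₂ → count P₁ ≡ c₁ → count P₂ ≡ c₂ → 4 * suc n + 2 * count P ≤ weight J P + r
    cases zero zero e₁ e₂ =
      contradiction (≤-trans 1≤k (subst (k ≤_) (trans count-join (cong₂ _+_ e₁ e₂)) k≤c)) λ ()
    cases (suc _) zero e₁ e₂ = one-sided (growˡ P₁ (subst (k ≤_) count≡ k≤c))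
      (exp₁ P₁ (subst (1 ≤_) count≡ (≤-trans 1≤k k≤c))) (weight-join-ˡ P (count-zero P₂ e₂)) count≡
      where
      count≡ : count P ≡ count P₁
      count≡ = trans count-join (trans (cong (count P₁ +_) e₂) (+-identityʳ _))
    cases zero (suc _) e₁ e₂ = one-sided (growʳ P₂ (subst (k ≤_) count≡ k≤c))
      (exp₂ P₂ (subst (1 ≤_) count≡ (≤-trans 1≤k k≤c))) (weight-join-ʳ P (count-zero P₁ e₁)) count≡
      where
      count≡ : count P ≡ count P₂
      count≡ = trans count-join (cong (_+ count P₂) e₁)
    -- Both halves are met, so `4 * n` is available twice. The second copy has to cover the total
    -- slack 8 and the 4 for the new dimension, whence `12 ≤ 4 * n`.
    cases (suc _) (suc _) e₁ e₂ = +-cancelʳ-≤ 8 _ _ (begin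
      4 * suc n + 2 * count P + 8                        ≡⟨ cong (λ c → 4 * suc n + 2 * c + 8) count-join ⟩
      4 * suc n + 2 * (count P₁ + count P₂) + 8          ≡⟨ lhs n (count P₁) (count P₂) ⟩
      4 * n + 2 * count P₁ + (2 * count P₂ + 12)
        ≤⟨ +-monoʳ-≤ (4 * n + 2 * count P₁) (+-monoʳ-≤ (2 * count P₂) (≤-trans (m≤n+m 12 4) (*-monoʳ-≤ 4 4≤n))) ⟩
      4 * n + 2 * count P₁ + (2 * count P₂ + 4 * n)
        ≤⟨ +-mono-≤ (exp₁ P₁ (subst (1 ≤_) (sym e₁) (s≤s z≤n)))
             (subst (_≤ weight G₂ P₂ + 4) (+-comm (4 * n) _) (exp₂ P₂ (subst (1 ≤_) (sym e₂) (s≤s z≤n)))) ⟩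
      weight G₁ P₁ + 4 + (weight G₂ P₂ + 4)              ≡⟨ rhs (weight G₁ P₁) (weight G₂ P₂) ⟩
      weight G₁ P₁ + weight G₂ P₂ + 8                    ≤⟨ +-monoˡ-≤ 8 (≤-trans (weight-join P) (m≤m+n _ r)) ⟩
      weight J P + r + 8 ∎)
      where
      lhs : ∀ n a b → 4 * suc n + 2 * (a + b) + 8 ≡ 4 * n + 2 * a + (2 * b + 12)
      lhs = solve-∀
      rhs : ∀ a b → a + 4 + (b + 4) ≡ a + b + 8
      rhs = solve-∀

-- Vertex growth across two disjoint matchings

module _ (p q : Fin m → Fin m) (R : Graph m) (p-edge : ∀ x → R x (p x) ≡ true) (q-edge : ∀ x → R x (q x) ≡ true)
         (disjoint : ∀ x → p x ≢ q x) where

  -- `R` is any relation containing both matchings, so the same lemma covers `cross p q` and its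
  -- reverse, where `p⁻¹` and `q⁻¹` take the place of `p` and `q`.
  growing-1 : Growing 1 R
  growing-1 P h with count-positive P h
  ... | x , Px = 2≤count (nbhd R P) (nbhd-intro R P Px (q-edge x)) (nbhd-intro R P Px (p-edge x)) (disjoint x)

  -- The neighbours of x and x′ are p x ≢ p x′ together with q x and q x′; without
  -- a 4-cycle the latter two are not just p x′ and p x.
  growing-2 : Injective _≡_ _≡_ p → (∀ x x′ → x′ ≢ x → q x ≡ p x′ → q x′ ≢ p x) → Growing 2 R
  growing-2 p-inj no-4-cycle P h with two-elements P h
  ... | x , x′ , Px , Px′ , x′≢x with q x ≟ p x′
  ...   | no qx≢px′ = 3≤count (nbhd R P) (nbhd-intro R P Px (p-edge x)) (nbhd-intro R P Px′ (p-edge x′))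
            (nbhd-intro R P Px (q-edge x)) (x′≢x ∘ p-inj) (disjoint x ∘ sym) qx≢px′
  ...   | yes qx≡px′ = 3≤count (nbhd R P) (nbhd-intro R P Px (p-edge x)) (nbhd-intro R P Px′ (p-edge x′))
            (nbhd-intro R P Px′ (q-edge x′)) (x′≢x ∘ p-inj) (no-4-cycle x x′ x′≢x qx≡px′) (disjoint x′ ∘ sym)

module _ (π₁ π₂ : Permutation′ m) (disjoint : ∀ x → π₁ ⟨$⟩ʳ x ≢ π₂ ⟨$⟩ʳ x) where

  private
    p q p⁻¹ q⁻¹ : Fin m → Fin m
    p = π₁ ⟨$⟩ʳ_
    q = π₂ ⟨$⟩ʳ_
    p⁻¹ = π₁ ⟨$⟩ˡ_
    q⁻¹ = π₂ ⟨$⟩ˡ_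
    M M⁻¹ : Graph m
    M = cross p q
    M⁻¹ y x = cross p q x y

    disjoint⁻¹ : ∀ y → p⁻¹ y ≢ q⁻¹ y
    disjoint⁻¹ y eq = disjoint (p⁻¹ y) (trans (inverseʳ π₁) (trans (sym (inverseʳ π₂)) (cong q (sym eq))))

    p-edge : ∀ x → M x (p x) ≡ true
    p-edge x = ∨-introˡ (isYes-true (p x ≟ p x) refl)
    q-edge : ∀ x → M x (q x) ≡ true
    q-edge x = ∨-introʳ (isYes-true (q x ≟ q x) refl)
    p⁻¹-edge : ∀ y → M⁻¹ y (p⁻¹ y) ≡ true
    p⁻¹-edge y = ∨-introˡ (isYes-true (y ≟ p (p⁻¹ y)) (sym (inverseʳ π₁)))
    q⁻¹-edge : ∀ y → M⁻¹ y (q⁻¹ y) ≡ true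
    q⁻¹-edge y = ∨-introʳ (isYes-true (y ≟ q (q⁻¹ y)) (sym (inverseʳ π₂)))

    p-injective : Injective _≡_ _≡_ p
    p-injective eq = trans (sym (inverseˡ π₁)) (trans (cong p⁻¹ eq) (inverseˡ π₁))
    p⁻¹-injective : Injective _≡_ _≡_ p⁻¹
    p⁻¹-injective eq = trans (sym (inverseʳ π₁)) (trans (cong p eq) (inverseʳ π₁))
    q⁻¹-injective : Injective _≡_ _≡_ q⁻¹
    q⁻¹-injective eq = trans (sym (inverseʳ π₂)) (trans (cong q eq) (inverseʳ π₂))

    -- Seen from a right-hand vertex, the cross neighbours become an explicit pair on the left, so
    -- that `count-pair` gives their number.
    cross-flip : ∀ b a → cross p q a b ≡ ⌊ a ≟ p⁻¹ b ⌋ ∨ ⌊ a ≟ q⁻¹ b ⌋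
    cross-flip b a = cong₂ _∨_ (flip π₁) (flip π₂)
      where
      flip : (π : Permutation′ m) → ⌊ b ≟ π ⟨$⟩ʳ a ⌋ ≡ ⌊ a ≟ π ⟨$⟩ˡ b ⌋
      flip π with b ≟ π ⟨$⟩ʳ a | a ≟ π ⟨$⟩ˡ b
      ... | yes _ | yes _ = refl
      ... | no _  | no _  = refl
      ... | yes e | no ¬f = contradiction (trans (sym (inverseˡ π)) (cong (π ⟨$⟩ˡ_) (sym e))) ¬f
      ... | no ¬e | yes f = contradiction (trans (sym (inverseʳ π)) (cong (π ⟨$⟩ʳ_) (sym f))) ¬e

  -- The cycle is `x`, `p x` = `q x′`, `x′`, `p x′` = `q x`, alternating between the two matchings.
  four-cycle : ∀ x x′ → x′ ≢ x → q x ≡ p x′ → q x′ ≡ p x → HasCycle (matchingGraph p q) 3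
  four-cycle x x′ x′≢x qx qx′ = w , w-injective , edge , closing
    where
    w : Fin 4 → Fin (m + m)
    w zero                   = x ↑ˡ m
    w (suc zero)             = m ↑ʳ p x
    w (suc (suc zero))       = x′ ↑ˡ m
    w (suc (suc (suc zero))) = m ↑ʳ p x′

    ø : Graph m
    ø _ _ = false

    ˡ≢ʳ : ∀ {a b : Fin m} → a ↑ˡ m ≢ m ↑ʳ b
    ˡ≢ʳ {a} {b} eq with trans (sym (splitAt-↑ˡ m a m)) (trans (cong (splitAt m) eq) (splitAt-↑ʳ m m b))
    ... | ()

    w-injective : Injective _≡_ _≡_ w
    w-injective {zero}                   {zero}                   _  = refl
    w-injective {zero}                   {suc zero}               eq = contradiction eq ˡ≢ʳ
    w-injective {zero}                   {suc (suc zero)}         eq = contradiction (sym (↑ˡ-injective m _ _ eq)) x′≢x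
    w-injective {zero}                   {suc (suc (suc zero))}   eq = contradiction eq ˡ≢ʳ
    w-injective {suc zero}               {zero}                   eq = contradiction (sym eq) ˡ≢ʳ
    w-injective {suc zero}               {suc zero}               _  = refl
    w-injective {suc zero}               {suc (suc zero)}         eq = contradiction (sym eq) ˡ≢ʳ
    w-injective {suc zero}               {suc (suc (suc zero))}   eq =
      contradiction (sym (p-injective (↑ʳ-injective m _ _ eq))) x′≢x
    w-injective {suc (suc zero)}         {zero}                   eq = contradiction (↑ˡ-injective m _ _ eq) x′≢x
    w-injective {suc (suc zero)}         {suc zero}               eq = contradiction eq ˡ≢ʳ
    w-injective {suc (suc zero)}         {suc (suc zero)}         _  = refl
    w-injective {suc (suc zero)}         {suc (suc (suc zero))}   eq = contradiction eq ˡ≢ʳ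
    w-injective {suc (suc (suc zero))}   {zero}                   eq = contradiction (sym eq) ˡ≢ʳ
    w-injective {suc (suc (suc zero))}   {suc zero}               eq =
      contradiction (p-injective (↑ʳ-injective m _ _ eq)) x′≢x
    w-injective {suc (suc (suc zero))}   {suc (suc zero)}         eq = contradiction (sym eq) ˡ≢ʳ
    w-injective {suc (suc (suc zero))}   {suc (suc (suc zero))}   _  = refl

    edge : ∀ (i : Fin 3) → matchingGraph p q (w (inject₁ i)) (w (suc i)) ≡ true
    edge zero             = trans (join-ˡʳ ø ø p q x (p x)) (p-edge x)
    edge (suc zero)       = trans (join-ʳˡ ø ø p q (p x) x′) (trans (cong (M x′) (sym qx′)) (q-edge x′))
    edge (suc (suc zero)) = trans (join-ˡʳ ø ø p q x′ (p x′)) (p-edge x′)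

    closing : matchingGraph p q (m ↑ʳ p x′) (x ↑ˡ m) ≡ true
    closing = trans (join-ʳˡ ø ø p q (p x′) x) (trans (cong (M x) (sym qx)) (q-edge x))

  module _ {G₁ G₂ : Graph m} (4≤n : 4 ≤ n) (C₁ : Cube n G₁) (C₂ : Cube n G₂) where

    private
      module C₁ = Cube C₁
      module C₂ = Cube C₂
      J : Graph (m + m)
      J = join G₁ G₂ p q

    Cube-join : Cube (suc n) J
    Cube-join = record
      { vertex    = C₁.vertex ↑ˡ m
      ; symmetric = split-elim m _
          (λ a → split-elim m _
            (λ b → trans (join-ˡˡ G₁ G₂ p q a b) (trans (C₁.symmetric a b) (sym (join-ˡˡ G₁ G₂ p q b a))))
            (λ b → trans (join-ˡʳ G₁ G₂ p q a b) (sym (join-ʳˡ G₁ G₂ p q b a))))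
          (λ a → split-elim m _
            (λ b → trans (join-ʳˡ G₁ G₂ p q a b) (sym (join-ˡʳ G₁ G₂ p q b a)))
            (λ b → trans (join-ʳʳ G₁ G₂ p q a b) (trans (C₂.symmetric a b) (sym (join-ʳʳ G₁ G₂ p q b a)))))
      ; loopless  = split-elim m _
          (λ a → trans (join-ˡˡ G₁ G₂ p q a a) (C₁.loopless a))
          (λ a → trans (join-ʳʳ G₁ G₂ p q a a) (C₂.loopless a))
      ; regular   = split-elim m _
          (λ a → trans (cong suc (begin
              count (J (a ↑ˡ m)) ≡⟨ sum-++ m (λ v → ⟦ J (a ↑ˡ m) v ⟧) ⟩
              count (λ b → J (a ↑ˡ m) (b ↑ˡ m)) + count (λ b → J (a ↑ˡ m) (m ↑ʳ b))
                ≡⟨ cong₂ _+_ (sum-cong-≗ λ b → cong ⟦_⟧ (join-ˡˡ G₁ G₂ p q a b))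
                             (sum-cong-≗ λ b → cong ⟦_⟧ (join-ˡʳ G₁ G₂ p q a b)) ⟩
              count (G₁ a) + count (cross p q a) ≡⟨ cong (count (G₁ a) +_) (count-pair (disjoint a)) ⟩
              count (G₁ a) + 2 ∎))
            (degree _ (C₁.regular a)))
          (λ b → trans (cong suc (begin
              count (J (m ↑ʳ b)) ≡⟨ sum-++ m (λ v → ⟦ J (m ↑ʳ b) v ⟧) ⟩
              count (λ a → J (m ↑ʳ b) (a ↑ˡ m)) + count (λ a → J (m ↑ʳ b) (m ↑ʳ a))
                ≡⟨ cong₂ _+_ (sum-cong-≗ λ a → cong ⟦_⟧ (trans (join-ʳˡ G₁ G₂ p q b a) (cross-flip b a)))
                             (sum-cong-≗ λ a → cong ⟦_⟧ (join-ʳʳ G₁ G₂ p q b a)) ⟩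
              count (λ a → ⌊ a ≟ p⁻¹ b ⌋ ∨ ⌊ a ≟ q⁻¹ b ⌋) + count (G₂ b)
                ≡⟨ cong (_+ count (G₂ b)) (count-pair (disjoint⁻¹ b)) ⟩
              2 + count (G₂ b) ≡⟨ +-comm 2 _ ⟩
              count (G₂ b) + 2 ∎))
            (degree _ (C₂.regular b)))
      ; expanding = Expanding-join G₁ G₂ p q {n} 1 4 (s≤s z≤n) refl 4≤n
          (growing-1 p q M p-edge q-edge disjoint)
          (growing-1 p⁻¹ q⁻¹ M⁻¹ p⁻¹-edge q⁻¹-edge disjoint⁻¹)
          C₁.expanding C₂.expanding
      }
      where
      open ≡-Reasoning
      degree : ∀ d → suc d ≡ n + n → suc (d + 2) ≡ suc n + suc n
      degree d eq = trans (cong (_+ 2) eq) (shuffle n)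
        where
        shuffle : ∀ n → n + n + 2 ≡ suc n + suc n
        shuffle = solve-∀

    Expanding-2-join : ¬ HasCycle (matchingGraph p q) 3 → Expanding (suc n) 2 2 J
    Expanding-2-join acyclic = Expanding-join G₁ G₂ p q {n} 2 2 (s≤s z≤n) refl 4≤n
      (growing-2 p q M p-edge q-edge disjoint p-injective
        λ x x′ x′≢x qx qx′ → acyclic (four-cycle x x′ x′≢x qx qx′))
      (growing-2 p⁻¹ q⁻¹ M⁻¹ p⁻¹-edge q⁻¹-edge disjoint⁻¹ p⁻¹-injective
        -- A coincidence of the inverse matchings at `y` and `y′` is one of `p` and `q` at `q⁻¹ y`
        -- and `q⁻¹ y′`, so it yields a 4-cycle as before.
        λ y y′ y′≢y qy qy′ → acyclic (four-cycle (q⁻¹ y) (q⁻¹ y′) (y′≢y ∘ q⁻¹-injective)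
          (swap y y′ qy′) (swap y′ y qy)))
      C₁.expanding C₂.expanding
      where
      swap : ∀ y y′ → q⁻¹ y′ ≡ p⁻¹ y → q (q⁻¹ y) ≡ p (q⁻¹ y′)
      swap y y′ eq = trans (inverseʳ π₂) (trans (sym (inverseʳ π₁)) (cong p (sym eq)))

-- The augmented cube AQ₄

some-cong : {P Q : Fin m → Bool} → (∀ i → P i ≡ Q i) → some P ≡ some Q
some-cong {zero}  _ = refl
some-cong {suc m} h = cong₂ _∨_ (h zero) (some-cong (h ∘ suc))

count-cong : {P Q : Fin m → Bool} → (∀ i → P i ≡ Q i) → count P ≡ count Q
count-cong h = sum-cong-≗ λ i → cong ⟦_⟧ (h i)

weight-cong : (G : Graph m) {P Q : Fin m → Bool} → (∀ i → P i ≡ Q i) → weight G P ≡ weight G Q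
weight-cong G {P} {Q} h = cong₂ _+_
  (sum-cong-≗ λ i → count-cong λ j → cong₂ (λ a b → a ∧ b ∧ G i j) (h i) (h j))
  (cong (2 *_) boundary≡)
  where
  boundary≡ : count (boundary G P) ≡ count (boundary G Q)
  boundary≡ = count-cong λ y → cong₂ (λ a b → not a ∧ b) (h y) (some-cong λ x → cong (_∧ G x y) (h x))

-- Subsets are enumerated as bit vectors, where membership in the list is provable up to `_≡_`;
-- predicates are then matched pointwise through `tabulate`.
vecs : ∀ n → List (Vec Bool n)
vecs zero    = [] ∷ []
vecs (suc n) = map (true ∷_) (vecs n) ++ map (false ∷_) (vecs n)

∈-vecs : (v : Vec Bool n) → v ∈ vecs n
∈-vecs []          = here refl
∈-vecs (true  ∷ v) = ∈-++⁺ˡ (∈-map⁺ (true ∷_) (∈-vecs v))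
∈-vecs (false ∷ v) = ∈-++⁺ʳ (map (true ∷_) (vecs _)) (∈-map⁺ (false ∷_) (∈-vecs v))

glue : Vec Bool m → Vec Bool m → Fin (m + m) → Bool
glue {m} u v i = [ Vec.lookup u , Vec.lookup v ]′ (splitAt m i)

glue-tabulate : (P : Fin (m + m) → Bool) → ∀ i →
                P i ≡ glue (Vec.tabulate (λ a → P (a ↑ˡ m))) (Vec.tabulate (λ b → P (m ↑ʳ b))) i
glue-tabulate {m} P = split-elim m _
  (λ a → trans (sym (lookup∘tabulate _ a)) (sym (cong [ _ , _ ]′ (splitAt-↑ˡ m a m))))
  (λ b → trans (sym (lookup∘tabulate _ b)) (sym (cong [ _ , _ ]′ (splitAt-↑ʳ m m b))))

expands : (k r c w : ℕ) → Bool
expands k r c w = (c <ᵇ k) ∨ (4 * 4 + 2 * c ≤ᵇ w + r)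

expands-sound : ∀ k r c w → expands k r c w ≡ true → k ≤ c → 4 * 4 + 2 * c ≤ w + r
expands-sound k r c w h k≤c with ∨-elim {c <ᵇ k} h
... | inj₁ c<k = contradiction (≤-trans (<ᵇ⇒< c k (Equivalence.from T-≡ c<k)) k≤c) 1+n≰n
... | inj₂ le  = ≤ᵇ⇒≤ _ _ (Equivalence.from T-≡ le)

both-expand : (c w : ℕ) → Bool
both-expand c w = expands 1 4 c w ∧ expands 2 2 c w

-- Size and weight are kept with each subset of a half, to be computed once per subset and not once
-- per pair.
record Profile (m : ℕ) : Set where
  constructor mkProfile
  field
    bits  : Vec Bool m
    size₁ : ℕ
    weight₁ : ℕ

module _ (G : Graph m) (p q : Fin m → Fin m) where

  private
    J : Graph (m + m)
    J = join G G p q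

  profile : Vec Bool m → Profile m
  profile v = mkProfile v (count (Vec.lookup v)) (weight G (Vec.lookup v))

  -- The weights of the two halves mostly suffice; only the few remaining sets are examined in J.
  pair-expands : Profile m → Profile m → Bool
  pair-expands (mkProfile u c₁ w₁) (mkProfile v c₂ w₂) =
    expands 0 2 (c₁ + c₂) (w₁ + w₂) ∨ both-expand (count (glue u v)) (weight J (glue u v))

  -- The profiles are shared between all pairs because the list is an argument.
  all-pairs-expand : List (Profile m) → Bool
  all-pairs-expand ps = all (λ s → all (pair-expands s) ps) ps

  all-pairs-sound : ∀ ps → all-pairs-expand ps ≡ true → ∀ {s t} → s ∈ ps → t ∈ ps → pair-expands s t ≡ true
  all-pairs-sound ps h {s} s∈ t∈ = Equivalence.to T-≡
    (All.lookup (all⁺ (pair-expands s) ps (All.lookup (all⁺ (λ s → all (pair-expands s) ps) ps (Equivalence.from T-≡ h)) s∈)) t∈)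

  -- A record, so that conversion checking never unfolds the computation.
  record PairsExpand : Set where
    constructor verified
    field
      computation : all-pairs-expand (map profile (vecs m)) ≡ true

  module _ (h : PairsExpand) where

    -- The bound with constant 2 and no condition on `count P` implies both required bounds, and by
    -- `weight-join` it passes from the two halves to `J`. Other pairs were tested in `J` itself.
    expanding-cases : ∀ P → 4 * 4 + 2 * count P ≤ weight J P + 2 ⊎ both-expand (count P) (weight J P) ≡ true
    expanding-cases P
      with ∨-elim {expands 0 2 (count (Vec.lookup u) + count (Vec.lookup v)) (weight G (Vec.lookup u) + weight G (Vec.lookup v))}
                  {both-expand (count (glue u v)) (weight J (glue u v))}
                  (all-pairs-sound (map profile (vecs m)) (PairsExpand.computation h) (∈-map⁺ profile (∈-vecs u)) (∈-map⁺ profile (∈-vecs v)))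
      where
      u v : Vec Bool m
      u = Vec.tabulate (λ a → P (a ↑ˡ m))
      v = Vec.tabulate (λ b → P (m ↑ʳ b))
    ... | inj₂ glued = inj₂ (trans
            (cong₂ both-expand (count-cong (glue-tabulate {m} P)) (weight-cong J (glue-tabulate {m} P)))
            glued)
    ... | inj₁ halves = inj₁ (begin
      4 * 4 + 2 * count P             ≡⟨ cong (λ c → 4 * 4 + 2 * c) (sum-++ m (λ i → ⟦ P i ⟧)) ⟩
      4 * 4 + 2 * (count P₁ + count P₂)
        ≡⟨ cong (λ c → 4 * 4 + 2 * c) (sym (cong₂ _+_ (count-cong (lookup∘tabulate P₁)) (count-cong (lookup∘tabulate P₂)))) ⟩
      4 * 4 + 2 * (count (Vec.lookup u) + count (Vec.lookup v))
        ≤⟨ expands-sound 0 2 (count (Vec.lookup u) + count (Vec.lookup v)) _ halves z≤n ⟩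
      weight G (Vec.lookup u) + weight G (Vec.lookup v) + 2
        ≡⟨ cong (_+ 2) (cong₂ _+_ (weight-cong G (lookup∘tabulate P₁)) (weight-cong G (lookup∘tabulate P₂))) ⟩
      weight G P₁ + weight G P₂ + 2 ≤⟨ +-monoˡ-≤ 2 (weight-join G G p q P) ⟩
      weight J P + 2 ∎)
      where
      open ≤-Reasoning
      P₁ P₂ : Fin m → Bool
      P₁ a = P (a ↑ˡ m)
      P₂ b = P (m ↑ʳ b)
      u v : Vec Bool m
      u = Vec.tabulate P₁
      v = Vec.tabulate P₂

    expanding-1 : Expanding 4 1 4 J
    expanding-1 P ne with expanding-cases P
    ... | inj₁ le   = ≤-trans le (+-monoʳ-≤ (weight J P) (s≤s (s≤s z≤n)))
    ... | inj₂ both = expands-sound 1 4 _ _ (∧-conicalˡ (expands 1 4 (count P) (weight J P)) _ both) ne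

    expanding-2 : Expanding 4 2 2 J
    expanding-2 P 2≤ with expanding-cases P
    ... | inj₁ le   = le
    ... | inj₂ both = expands-sound 2 2 _ _ (∧-conicalʳ (expands 1 4 (count P) (weight J P)) _ both) 2≤

-- `AQ₄` unfolds to this join of two copies of AQ₃. With 8 vertices per half there are 256 profiles,
-- hence 65536 ordered pairs, and `refl` evaluates the check.
AQ₄-pairs : PairsExpand (AQ 2) (λ x → x) (compl 2)
AQ₄-pairs = verified refl

AQ₄-cube : Cube 4 AQ₄
AQ₄-cube = record
  { vertex    = zero
  ; symmetric = toWitness {a? = all? λ u → all? λ v → AQ₄ u v ≟ᵇ AQ₄ v u} _
  ; loopless  = toWitness {a? = all? λ v → AQ₄ v v ≟ᵇ false} _
  ; regular   = toWitness {a? = all? λ v → suc (count (AQ₄ v)) ≟ⁿ 8} _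
  ; expanding = expanding-1 (AQ 2) (λ x → x) (compl 2) AQ₄-pairs
  }

AQ₄-expanding-2 : Expanding 4 2 2 AQ₄
AQ₄-expanding-2 = expanding-2 (AQ 2) (λ x → x) (compl 2) AQ₄-pairs

-- Induction over the two cube families

GAQ⇒4≤n : ∀ {G : Graph m} → GAQ n m G → 4 ≤ n
GAQ⇒4≤n base                 = ≤-refl
GAQ⇒4≤n (step _ _ g _ _)     = ≤-trans (GAQ⇒4≤n g) (n≤1+n _)
GAQ⇒4≤n (iso g _)            = GAQ⇒4≤n g

GAQ⇒Cube : ∀ {G : Graph m} → GAQ n m G → Cube n G
GAQ⇒Cube base                       = AQ₄-cube
GAQ⇒Cube (step π₁ π₂ g₁ g₂ disjoint) = Cube-join π₁ π₂ disjoint (GAQ⇒4≤n g₁) (GAQ⇒Cube g₁) (GAQ⇒Cube g₂)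
GAQ⇒Cube (iso g G≅H)                = Cube-iso G≅H (GAQ⇒Cube g)

RGAQ⇒GAQ : ∀ {G : Graph m} → RGAQ n m G → GAQ n m G
RGAQ⇒GAQ base                            = base
RGAQ⇒GAQ (step π₁ π₂ g₁ g₂ disjoint _ _) = step π₁ π₂ g₁ g₂ disjoint
RGAQ⇒GAQ (iso g G≅H)                     = iso (RGAQ⇒GAQ g) G≅H

-- The gain of 1 arises at the outermost join from the basic expansion of the two halves, so
-- recursion passes only through `iso`.
RGAQ⇒Expanding-2 : ∀ {G : Graph m} → RGAQ n m G → Expanding n 2 2 G
RGAQ⇒Expanding-2 base = AQ₄-expanding-2
RGAQ⇒Expanding-2 (step π₁ π₂ g₁ g₂ disjoint no-4-cycle _) =
  Expanding-2-join π₁ π₂ disjoint (GAQ⇒4≤n g₁) (GAQ⇒Cube g₁) (GAQ⇒Cube g₂) no-4-cycle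
RGAQ⇒Expanding-2 {n = n} (iso g G≅H) = Expanding-iso G≅H {n} (RGAQ⇒Expanding-2 g)

theorem3p10 : (∀ n m (G : Graph m) → GAQ n m G → FracStronglyMaximallyMatched G) ×
    (∀ n m (G : Graph m) → RGAQ n m G → FracStronglySuperMatched G)
theorem3p10 = (λ n m G g → maximally-matched (GAQ⇒Cube g))
            , (λ n m G g → super-matched (GAQ⇒Cube (RGAQ⇒GAQ g)) (RGAQ⇒Expanding-2 g))
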